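{- The class $\mathcal{R}_3$ contains the Petersen graph, every prism $\mathrm{Pr}_n$ ($n\geq 3$), and every graph obtained from any of these by applying operations 1 and 2 an arbitrary number of times in any order, where operation 1 attaches to a vertex $v$ of the current graph a simple path of any length $\ell\geq 1$ whose other $\ell$ vertices are new, and operation 2 joins two vertices $x,y$ of the current graph by a simple path of length at least $3$ whose internal vertices are new.
   Context: All graphs are finite and simple. For a word $w$ and distinct letters $x,y$ occurring in $w$, $x$ and $y$ alternate in $w$ if deleting all letters other than copies of $x$ and $y$ from $w$ yields a word of the form $xyxy\cdots$ or $yxyx\cdots$ (of even or odd length). A graph $G=(V,E)$ is word-representable if there is a word $w$ over the alphabet $V$ (each vertex occurring in $w$) such that for all distinct $x,y\in V$, $x$ and $y$ alternate in $w$ if and only if $(x,y)\in E$. A word is $k$-uniform if each of its letters occurs exactly $k$ times; $G$ is $k$-word-representable if some $k$-uniform word represents it. The representation number $\mathcal{R}(G)$ of a word-representable graph is the least such $k$, and $\mathcal{R}_k$ denotes the class of word-representable graphs with representation number exactly $k$. For $n\geq 3$, the prism $\mathrm{Pr}_n$ consists of two cycles $1\,2\cdots n$ and $1'2'\cdots n'$ together with the edges $(i,i')$, $i=1,\ldots,n$. The length of a path is its number of edges. -}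

module Defs where

open import Data.Fin using (Fin; toℕ)
import Data.Fin.Properties as Fin
open import Data.List using (List; []; _∷_; filter; length)
import Data.List.Membership.Propositional as List
open import Data.Nat using (ℕ; zero; suc; _+_; _∸_; _%_; _≤_; z≤n; s≤s; _≟_)
open import Data.Nat.Properties using (1+n≢n)
open import Data.Product using (Σ-syntax; ∃-syntax; _×_; _,_)
open import Data.Sum using (_⊎_; inj₁; inj₂; swap)
open import Data.Sum.Function.Propositional using (_⊎-↔_)
open import Function.Bundles using (_↔_; _⇔_; Inverse)
open import Function.Construct.Composition using (_↔-∘_)
open import Function.Construct.Identity using (↔-id)
open import Function.Construct.Symmetry using (↔-sym)
open import Function.Properties.Inverse using (↔⇒↣)
open import Level using (0ℓ)
open import Relation.Binary using (Rel; REL; Decidable; DecidableEquality; Symmetric)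
open import Relation.Binary.Construct.Closure.ReflexiveTransitive using (Star)
open import Relation.Binary.PropositionalEquality using (_≡_; _≢_; refl; sym; trans; cong)
open import Relation.Nullary using (¬_)
open import Relation.Nullary.Decidable
  using (_×-dec_; _⊎-dec_; via-injection; from-yes; ¬?)
open import Relation.Unary using (Pred)

record Graph : Set₁ where
  infix 4 _~_ _~?_
  field
    V        : Set
    size     : ℕ
    finite   : V ↔ Fin size
    _~_      : Rel V 0ℓ
    _~?_     : Decidable _~_
    ~-sym    : Symmetric _~_
    ~-irrefl : ∀ {x} → ¬ (x ~ x)

  _≟ᵥ_ : DecidableEquality V
  _≟ᵥ_ = via-injection (↔⇒↣ finite) Fin._≟_

open Graph using (V)

record _≅_ (G H : Graph) : Set where
  private
    module G = Graph G
    module H = Graph H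
  field
    bijection : V G ↔ V H
  open Inverse bijection using (to)
  field
    preserves : ∀ x y → (x G.~ y) ⇔ (to x H.~ to y)

infix 4 _≅_

-- The word  x y x y ⋯  of length n.
alternating : {A : Set} → A → A → ℕ → List A
alternating x y zero    = []
alternating x y (suc n) = x ∷ alternating y x n

module _ (G : Graph) where
  open Graph G

  restrict : V G → V G → List (V G) → List (V G)
  restrict x y = filter (λ z → (z ≟ᵥ x) ⊎-dec (z ≟ᵥ y))

  Alternate : List (V G) → V G → V G → Set
  Alternate w x y =
    ∃[ n ] (restrict x y w ≡ alternating x y n ⊎ restrict x y w ≡ alternating y x n)

  Represents : List (V G) → Set
  Represents w =
    (∀ x → x List.∈ w) × (∀ x y → x ≢ y → Alternate w x y ⇔ (x ~ y))

  WordRepresentable : Set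
  WordRepresentable = ∃[ w ] Represents w

  Uniform : ℕ → List (V G) → Set
  Uniform k w = ∀ x → length (filter (x ≟ᵥ_) w) ≡ k

  UniformlyRepresentable : ℕ → Set
  UniformlyRepresentable k = ∃[ w ] (Uniform k w × Represents w)

  IsRepresentationNumber : ℕ → Set
  IsRepresentationNumber k =
    UniformlyRepresentable k × (∀ j → UniformlyRepresentable j → k ≤ j)

ℛ : ℕ → Pred Graph 0ℓ
ℛ k G = WordRepresentable G × IsRepresentationNumber G k

-- The disjoint union of G and H together with the cross edges given by L.
glue : (G H : Graph) (L : REL (V G) (V H) 0ℓ) → Decidable L → Graph
glue G H L L? = record
  { V        = V G ⊎ V H
  ; size     = G.size + H.size
  ; finite   = ↔-sym Fin.+↔⊎ ↔-∘ (G.finite ⊎-↔ H.finite)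
  ; _~_      = adj
  ; _~?_     = adj?
  ; ~-sym    = λ {x} {y} → adj-sym x y
  ; ~-irrefl = λ {x} → adj-irrefl x
  }
  where
  module G = Graph G
  module H = Graph H

  adj : Rel (V G ⊎ V H) 0ℓ
  adj (inj₁ u) (inj₁ v) = u G.~ v
  adj (inj₁ u) (inj₂ v) = L u v
  adj (inj₂ u) (inj₁ v) = L v u
  adj (inj₂ u) (inj₂ v) = u H.~ v

  adj? : Decidable adj
  adj? (inj₁ u) (inj₁ v) = u G.~? v
  adj? (inj₁ u) (inj₂ v) = L? u v
  adj? (inj₂ u) (inj₁ v) = L? v u
  adj? (inj₂ u) (inj₂ v) = u H.~? v

  adj-sym : ∀ x y → adj x y → adj y x
  adj-sym (inj₁ u) (inj₁ v) = G.~-sym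
  adj-sym (inj₁ u) (inj₂ v) e = e
  adj-sym (inj₂ u) (inj₁ v) e = e
  adj-sym (inj₂ u) (inj₂ v) = H.~-sym

  adj-irrefl : ∀ x → ¬ adj x x
  adj-irrefl (inj₁ u) = G.~-irrefl
  adj-irrefl (inj₂ u) = H.~-irrefl

-- The graph on Fin n whose edges are the pairs related by R in either order.
symmetrise : ∀ n (R : Rel (Fin n) 0ℓ) → Decidable R → (∀ i → ¬ R i i) → Graph
symmetrise n R R? irr = record
  { V        = Fin n
  ; size     = n
  ; finite   = ↔-id (Fin n)
  ; _~_      = λ i j → R i j ⊎ R j i
  ; _~?_     = λ i j → R? i j ⊎-dec R? j i
  ; ~-sym    = swap
  ; ~-irrefl = λ { {i} (inj₁ r) → irr i r ; {i} (inj₂ r) → irr i r }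
  }

-- The path with n vertices (hence n ∸ 1 edges).
path : ℕ → Graph
path n = symmetrise n
  (λ i j → suc (toℕ i) ≡ toℕ j)
  (λ i j → suc (toℕ i) ≟ toℕ j)
  (λ i → 1+n≢n)

cycle : ∀ n → 3 ≤ n → Graph
cycle n 3≤n = symmetrise n
  (λ i j → suc (toℕ i) ≡ toℕ j ⊎ (suc (toℕ i) ≡ n × toℕ j ≡ 0))
  (λ i j → (suc (toℕ i) ≟ toℕ j) ⊎-dec ((suc (toℕ i) ≟ n) ×-dec (toℕ j ≟ 0)))
  (λ { i (inj₁ e)       → 1+n≢n e
     ; i (inj₂ (e , z)) → n≢1 3≤n (trans (sym e) (cong suc z)) })
  where
  n≢1 : ∀ {n} → 3 ≤ n → n ≢ 1
  n≢1 (s≤s ()) refl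

pentagram : Graph
pentagram = symmetrise 5
  (λ i j → (toℕ i + 2) % 5 ≡ toℕ j)
  (λ i j → (toℕ i + 2) % 5 ≟ toℕ j)
  (from-yes (Fin.all? {n = 5} λ i → ¬? ((toℕ i + 2) % 5 ≟ toℕ i)))

prism : ∀ n → 3 ≤ n → Graph
prism n 3≤n = glue (cycle n 3≤n) (cycle n 3≤n) _≡_ Fin._≟_

petersen : Graph
petersen = glue (cycle 5 (s≤s (s≤s (s≤s z≤n)))) pentagram _≡_ Fin._≟_

-- A path of length ℓ is attached at v: its ℓ vertices other than v are new.
attachPath : (G : Graph) → V G → ℕ → Graph
attachPath G v ℓ = glue G (path ℓ)
  (λ u i → u ≡ v × toℕ i ≡ 0)
  (λ u i → (u ≟ᵥ v) ×-dec (toℕ i ≟ 0))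
  where open Graph G using (_≟ᵥ_)

-- x and y are joined by a path of length ℓ: its ℓ ∸ 1 internal vertices are
-- new, the first one being adjacent to x and the last one to y.
joinByPath : (G : Graph) → V G → V G → ℕ → Graph
joinByPath G x y ℓ = glue G (path (ℓ ∸ 1))
  (λ u i → (u ≡ x × toℕ i ≡ 0) ⊎ (u ≡ y × suc (toℕ i) ≡ ℓ ∸ 1))
  (λ u i → ((u ≟ᵥ x) ×-dec (toℕ i ≟ 0)) ⊎-dec
           ((u ≟ᵥ y) ×-dec (suc (toℕ i) ≟ ℓ ∸ 1)))
  where open Graph G using (_≟ᵥ_)

-- The names of the new vertices are immaterial, so the result of an operation
-- is taken up to isomorphism.
data _↝_ (G H : Graph) : Set where
  operation₁ : ∀ v ℓ → 1 ≤ ℓ → H ≅ attachPath G v ℓ → G ↝ H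
  operation₂ : ∀ x y ℓ → x ≢ y → 3 ≤ ℓ → H ≅ joinByPath G x y ℓ → G ↝ H

infix 4 _↝_ _↝*_

_↝*_ : Graph → Graph → Set₁
_↝*_ = Star _↝_

IsPetersen : Pred Graph 0ℓ
IsPetersen G = G ≅ petersen

IsPrism : ℕ → Pred Graph 0ℓ
IsPrism n G = Σ[ 3≤n ∈ 3 ≤ n ] G ≅ prism n 3≤n

{-# OPTIONS --safe #-}

-- Lower bound.  A 2-uniform word is a chord diagram in which adjacency means
-- crossing.  If the graph without the closed neighbourhood of v is connected,
-- it lies on one side of the chord v, so the other, small side only contains
-- ends of neighbours of v.  Let b be the middle one of three ends on the small
-- side of v: the small side of b starts with the end before or after it, which
-- belongs to another neighbour of v.  So b lies on a triangle with v.  This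
-- settles the Petersen graph and the prisms with n ≥ 4; for n = 3 the same
-- argument is applied once more, to the third vertex of that triangle.  The
-- bound passes to all graphs that contain these as induced subgraphs.
--
-- Upper bound.  A path x u v y of length 3 is added to a 3-uniform word by
-- writing u x v u for one occurrence of x and v y u v for one occurrence of y;
-- suitable occurrences exist in each of the 20 patterns of x and y.  Longer
-- paths, and pendant paths, are induced subgraphs of iterations of this step.
-- The prisms with n ≥ 5 are represented by a word that is invariant, up to
-- rotation, under the rotation of the prism, which reduces the verification to
-- the first few letters.
module Submission where

open import Defs
open import Data.Bool using (Bool; true; false; not; T; if_then_else_; _∧_)
open import Data.Bool.ListAction using (any)
import Data.Bool.Properties as Bool
open import Data.Empty using (⊥; ⊥-elim)
open import Data.Fin using (Fin; zero; suc; toℕ)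
import Data.Fin as Fin
import Data.Fin.Properties as Fin
open import Data.List using (List; []; _∷_; _++_; map; mapMaybe; length; filter; replicate)
open import Data.List.Membership.Propositional using (find) renaming (_∈_ to _∈ˡ_)
open import Data.List.Membership.Propositional.Properties using (∈-++⁻; ∈-++⁺ˡ; ∈-++⁺ʳ)
open import Data.List.Properties
  using (∷-injective; map-++; map-injective; ++-assoc; ++-identityʳ; length-++;
         mapMaybe-++; mapMaybe-cong; mapMaybeIsInj₁∘mapInj₁)
open import Data.List.Relation.Unary.All as All using (All; []; _∷_)
open import Data.List.Relation.Unary.All.Properties using (¬All⇒Any¬; ++⁻)
open import Data.List.Relation.Unary.Any as Any using (here; there)
open import Data.List.Relation.Unary.Any.Properties using (any⁻)
open import Data.Maybe as Maybe using (Maybe; just; nothing; _>>=_)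
open import Data.Nat as Nat using (ℕ; zero; suc; _+_; _*_; _≤_; _<_; z≤n; s≤s; _%_; _/_)
open import Data.Nat.DivMod
  using (_mod_; m≡m%n+[m/n]*n; m<n⇒m%n≡m; [m+n]%n≡m%n; %-distribˡ-+; m%n<n; m%n%n≡m%n; n%n≡0)
import Data.Nat.Properties as Nat
open import Data.Product using (_×_; _,_; proj₁; proj₂; ∃; ∃-syntax)
open import Data.Sum as Sum using (_⊎_; inj₁; inj₂; isInj₁)
open import Data.Sum.Properties using (≡-dec; inj₁-injective; inj₂-injective)
open import Data.Unit using (⊤; tt)
open import Function using (_∘_; id; _⇔_; mk⇔; Equivalence; Inverse)
open import Level using (0ℓ)
open import Relation.Binary
  using (REL; Decidable; DecidableEquality; Symmetric; tri<; tri≈; tri>)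
open import Relation.Binary.Construct.Closure.ReflexiveTransitive using (ε; _◅_)
open import Relation.Binary.PropositionalEquality
  using (_≡_; _≢_; refl; sym; trans; cong; cong₂; subst; subst₂; module ≡-Reasoning)
open import Relation.Nullary using (¬_; Dec; yes; no; does; contradiction)
open import Relation.Nullary.Decidable
  using (dec-true; dec-false; _×-dec_; _⊎-dec_; _→-dec_; ¬?; T?; ⌊_⌋; True; toWitness; from-yes; map′)
open import Relation.Unary using (_∈_)

open Graph using (V)

-- Alternating patterns over two letters.

alternatesFrom : Bool → List Bool → Bool
alternatesFrom b     []          = true
alternatesFrom true  (true  ∷ p) = alternatesFrom false p
alternatesFrom true  (false ∷ p) = false
alternatesFrom false (true  ∷ p) = false
alternatesFrom false (false ∷ p) = alternatesFrom true p

isAlternating : List Bool → Bool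
isAlternating []      = true
isAlternating (b ∷ p) = alternatesFrom (not b) p

-- A Boolean test in place of an existential: on a concrete pattern it evaluates to `⊤` or `⊥`, so
-- finite checks are closed by `tt` or by an absurd pattern.
Alternating : List Bool → Set
Alternating p = T (isAlternating p)

alternatesFrom⇒≡ : ∀ b p → T (alternatesFrom b p) → p ≡ alternating b (not b) (length p)
alternatesFrom⇒≡ b     []          _ = refl
alternatesFrom⇒≡ true  (true  ∷ p) a = cong (true  ∷_) (alternatesFrom⇒≡ false p a)
alternatesFrom⇒≡ false (false ∷ p) a = cong (false ∷_) (alternatesFrom⇒≡ true  p a)

alternatesFrom-alternating : ∀ b n → T (alternatesFrom b (alternating b (not b) n))
alternatesFrom-alternating b     zero    = tt
alternatesFrom-alternating true  (suc n) = alternatesFrom-alternating false n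
alternatesFrom-alternating false (suc n) = alternatesFrom-alternating true n

Alternating⇒≡ : ∀ p → Alternating p →
  ∃[ n ] (p ≡ alternating true false n ⊎ p ≡ alternating false true n)
Alternating⇒≡ []          a = 0 , inj₁ refl
Alternating⇒≡ (true  ∷ p) a = suc (length p) , inj₁ (cong (true  ∷_) (alternatesFrom⇒≡ false p a))
Alternating⇒≡ (false ∷ p) a = suc (length p) , inj₂ (cong (false ∷_) (alternatesFrom⇒≡ true  p a))

Alternating-alternating : ∀ b n → Alternating (alternating b (not b) n)
Alternating-alternating b     zero    = tt
Alternating-alternating true  (suc n) = alternatesFrom-alternating false n
Alternating-alternating false (suc n) = alternatesFrom-alternating true n

alternatesFrom-++ˡ : ∀ b p q → T (alternatesFrom b (p ++ q)) → T (alternatesFrom b p)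
alternatesFrom-++ˡ b     []          q a = tt
alternatesFrom-++ˡ true  (true  ∷ p) q a = alternatesFrom-++ˡ false p q a
alternatesFrom-++ˡ false (false ∷ p) q a = alternatesFrom-++ˡ true p q a

Alternating-++ˡ : ∀ p q → Alternating (p ++ q) → Alternating p
Alternating-++ˡ []      q a = tt
Alternating-++ˡ (b ∷ p) q a = alternatesFrom-++ˡ (not b) p q a

alternatesFrom-++ʳ : ∀ b p q → T (alternatesFrom b (p ++ q)) → Alternating q
alternatesFrom-++ʳ b     []          []          a = tt
alternatesFrom-++ʳ true  []          (true  ∷ q) a = a
alternatesFrom-++ʳ false []          (false ∷ q) a = a
alternatesFrom-++ʳ true  (true  ∷ p) q a = alternatesFrom-++ʳ false p q a
alternatesFrom-++ʳ false (false ∷ p) q a = alternatesFrom-++ʳ true p q a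

Alternating-++ʳ : ∀ p q → Alternating (p ++ q) → Alternating q
Alternating-++ʳ []      q a = a
Alternating-++ʳ (b ∷ p) q a = alternatesFrom-++ʳ (not b) p q a

-- Restriction of words, counting, and rotation.

only : Bool → Bool → Maybe ⊤
only true  true  = just tt
only false false = just tt
only _     _     = nothing

-- Restricting to one letter, to two letters or to a subgraph is always a `mapMaybe`. Restrictions
-- therefore compose by `mapMaybe-∘`, and counts are lengths of restrictions.
#_ : ∀ {A B : Set} → (A → Maybe B) → List A → ℕ
(# h) w = length (mapMaybe h w)

module _ {A B C : Set} (g : A → Maybe B) (h : B → Maybe C) where

  mapMaybe-∘ : ∀ w → mapMaybe h (mapMaybe g w) ≡ mapMaybe (λ z → g z >>= h) w
  mapMaybe-∘ []      = refl
  mapMaybe-∘ (x ∷ w) with g x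
  ... | nothing = mapMaybe-∘ w
  ... | just y with h y
  ...   | nothing = mapMaybe-∘ w
  ...   | just z  = cong (z ∷_) (mapMaybe-∘ w)

mapMaybe-∘-cong : ∀ {A B C : Set} {g : A → Maybe B} {h : B → Maybe C} {k : A → Maybe C} →
  (∀ z → (g z >>= h) ≡ k z) → ∀ w → mapMaybe h (mapMaybe g w) ≡ mapMaybe k w
mapMaybe-∘-cong {g = g} {h} e w = trans (mapMaybe-∘ g h w) (mapMaybe-cong e w)

#-++ : ∀ {A B : Set} (h : A → Maybe B) u v → (# h) (u ++ v) ≡ (# h) u + (# h) v
#-++ h u v = trans (cong length (mapMaybe-++ h u v)) (length-++ (mapMaybe h u))

-- An alternating pattern with equally many letters of both kinds does not end
-- in the letter it starts with.
alternatesFrom-∷ʳ : ∀ b p → T (alternatesFrom b p) →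
    (T (alternatesFrom b (p ++ b ∷ [])) × (# only b) p ≡ (# only (not b)) p)
  ⊎ (# only b) p ≡ suc ((# only (not b)) p)
alternatesFrom-∷ʳ true  []          a = inj₁ (tt , refl)
alternatesFrom-∷ʳ false []          a = inj₁ (tt , refl)
alternatesFrom-∷ʳ true  (true ∷ []) a = inj₂ refl
alternatesFrom-∷ʳ false (false ∷ []) a = inj₂ refl
alternatesFrom-∷ʳ true  (true ∷ false ∷ p) a with alternatesFrom-∷ʳ true p a
... | inj₁ (a′ , e) = inj₁ (a′ , cong suc e)
... | inj₂ e        = inj₂ (cong suc e)
alternatesFrom-∷ʳ false (false ∷ true ∷ p) a with alternatesFrom-∷ʳ false p a
... | inj₁ (a′ , e) = inj₁ (a′ , cong suc e)
... | inj₂ e        = inj₂ (cong suc e)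

alternatesFrom⇒Alternating : ∀ b p → T (alternatesFrom b p) → Alternating p
alternatesFrom⇒Alternating b     []          a = tt
alternatesFrom⇒Alternating true  (true  ∷ p) a = a
alternatesFrom⇒Alternating false (false ∷ p) a = a

-- With equal counts the pattern ends in the other letter, so its first letter may be appended once
-- more and then dropped from the front.
Alternating-rotate₁ : ∀ b p → (# only true) (b ∷ p) ≡ (# only false) (b ∷ p) →
  Alternating (b ∷ p) → Alternating (p ++ b ∷ [])
Alternating-rotate₁ true p e a with alternatesFrom-∷ʳ true (true ∷ p) a
... | inj₁ (a′ , _) = alternatesFrom⇒Alternating false (p ++ true ∷ []) a′
... | inj₂ e′       = contradiction (trans (sym e′) e) Nat.1+n≢n
Alternating-rotate₁ false p e a with alternatesFrom-∷ʳ false (false ∷ p) a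
... | inj₁ (a′ , _) = alternatesFrom⇒Alternating true (p ++ false ∷ []) a′
... | inj₂ e′       = contradiction (trans (sym e′) (sym e)) Nat.1+n≢n

#-swap : ∀ {A B : Set} (h : A → Maybe B) u v → (# h) (u ++ v) ≡ (# h) (v ++ u)
#-swap h u v = trans (#-++ h u v) (trans (Nat.+-comm ((# h) u) _) (sym (#-++ h v u)))

Alternating-rotate : ∀ p q → (# only true) (p ++ q) ≡ (# only false) (p ++ q) →
  Alternating (p ++ q) → Alternating (q ++ p)
Alternating-rotate []      q e a = subst Alternating (sym (++-identityʳ q)) a
Alternating-rotate (b ∷ p) q e a =
  subst Alternating (++-assoc q (b ∷ []) p)
    (Alternating-rotate p (q ++ b ∷ [])
      (subst (λ r → (# only true) r ≡ (# only false) r) (++-assoc p q (b ∷ []))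
        (trans (#-swap (only true) (p ++ q) (b ∷ []))
          (trans e (#-swap (only false) (b ∷ []) (p ++ q)))))
      (subst Alternating (++-assoc p q (b ∷ [])) (Alternating-rotate₁ b (p ++ q) e a)))

module _ {A : Set} (_≟_ : DecidableEquality A) where

  mono : A → A → Maybe ⊤
  mono x z = if does (z ≟ x) then just tt else nothing

  side : A → A → A → Maybe Bool
  side x y z = if does (z ≟ x) then just true else if does (z ≟ y) then just false else nothing

  -- Renaming x to `true` and y to `false` removes the alphabet, so that patterns from different
  -- graphs, and from finite models of them, can be compared as equal lists.
  trace : A → A → List A → List Bool
  trace x y = mapMaybe (side x y)

  mono-refl : ∀ x → mono x x ≡ just tt
  mono-refl x rewrite dec-true (x ≟ x) refl = refl

  mono-≢ : ∀ {x z} → z ≢ x → mono x z ≡ nothing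
  mono-≢ {x} {z} n rewrite dec-false (z ≟ x) n = refl

  side-left : ∀ x y → side x y x ≡ just true
  side-left x y rewrite dec-true (x ≟ x) refl = refl

  side-right : ∀ {x y} → x ≢ y → side x y y ≡ just false
  side-right {x} {y} n rewrite dec-false (y ≟ x) (n ∘ sym) | dec-true (y ≟ y) refl = refl

  side-other : ∀ {x y z} → z ≢ x → z ≢ y → side x y z ≡ nothing
  side-other {x} {y} {z} n m rewrite dec-false (z ≟ x) n | dec-false (z ≟ y) m = refl

  mono-unique : ∀ {x} {h : A → Maybe ⊤} → h x ≡ just tt → (∀ {z} → z ≢ x → h z ≡ nothing) →
    ∀ z → h z ≡ mono x z
  mono-unique {x} p q z with z ≟ x
  ... | yes refl = p
  ... | no n     = q n

  -- A map is recognised as `side x y` from its values at x, at y and elsewhere. The comparisons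
  -- across alphabets in `Presents-≟`, `Presentable-embedding`, `glue-presents` and `via-κ` have
  -- this form.
  side-unique : ∀ {x y} {h : A → Maybe Bool} → h x ≡ just true → h y ≡ just false →
    (∀ {z} → z ≢ x → z ≢ y → h z ≡ nothing) → ∀ z → h z ≡ side x y z
  side-unique {x} {y} p q r z with z ≟ x
  ... | yes refl = p
  ... | no n with z ≟ y
  ...   | yes refl = q
  ...   | no m     = r n m

  #-true : ∀ x y w → (# only true) (trace x y w) ≡ (# mono x) w
  #-true x y w = cong length (mapMaybe-∘-cong (λ z → step z) w)
    where
    step : ∀ z → (side x y z >>= only true) ≡ mono x z
    step z with z ≟ x
    ... | yes _ = refl
    ... | no _ with z ≟ y
    ...   | yes _ = refl
    ...   | no _  = refl

  #-false : ∀ {x y} → x ≢ y → ∀ w → (# only false) (trace x y w) ≡ (# mono y) w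
  #-false {x} {y} n w = cong length (mapMaybe-∘-cong (λ z → step z) w)
    where
    step : ∀ z → (side x y z >>= only false) ≡ mono y z
    step z with z ≟ x
    ... | yes refl rewrite dec-false (z ≟ y) n = refl
    ... | no _ with z ≟ y
    ...   | yes _ = refl
    ...   | no _  = refl

-- Uniform words representing a relation.

record Presents {A : Set} (_≟_ : DecidableEquality A) (_~_ : A → A → Set) (k : ℕ)
                (w : List A) : Set where
  field
    count   : ∀ x → (# mono _≟_ x) w ≡ k
    sound   : ∀ {x y} → x ≢ y → x ~ y → Alternating (trace _≟_ x y w)
    complete : ∀ {x y} → x ≢ y → Alternating (trace _≟_ x y w) → x ~ y

module _ {A : Set} (_≟_ : DecidableEquality A) where

  -- Equal counts make alternation a cyclic property. This lets a chord diagram be opened at any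
  -- chord, and lets the rotation of a prism act on its word.
  Alternating-pattern-rotate : ∀ u v {x y} → x ≢ y → (# mono _≟_ x) (u ++ v) ≡ (# mono _≟_ y) (u ++ v) →
    Alternating (trace _≟_ x y (u ++ v)) → Alternating (trace _≟_ x y (v ++ u))
  Alternating-pattern-rotate u v {x} {y} n e a =
    subst Alternating (sym (mapMaybe-++ s v u))
      (Alternating-rotate (mapMaybe s u) (mapMaybe s v)
        (subst (λ r → (# only true) r ≡ (# only false) r) (mapMaybe-++ s u v)
          (trans (#-true _≟_ x y (u ++ v)) (trans e (sym (#-false _≟_ n (u ++ v))))))
        (subst Alternating (mapMaybe-++ s u v) a))
    where s = side _≟_ x y

module _ {A : Set} {_≟_ : DecidableEquality A} {_~_ : A → A → Set} {k : ℕ} where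

  Presents-rotate : ∀ u v → Presents _≟_ _~_ k (u ++ v) → Presents _≟_ _~_ k (v ++ u)
  Presents-rotate u v P = record
    { count    = count′
    ; sound    = λ n e → Alternating-pattern-rotate _≟_ u v n (trans (count _) (sym (count _))) (sound n e)
    ; complete = λ n a → complete n
        (Alternating-pattern-rotate _≟_ v u n (trans (count′ _) (sym (count′ _))) a)
    }
    where
    open Presents P
    count′ : ∀ x → (# mono _≟_ x) (v ++ u) ≡ k
    count′ x = trans (#-swap (mono _≟_ x) v u) (count x)

-- The equality test of a glued graph comes from its enumeration by `Fin`; this allows working with
-- the structural test on sums instead.
Presents-≟ : ∀ {A : Set} {_~_ : A → A → Set} {k w} {_≟_ _≟′_ : DecidableEquality A} →
  Presents _≟_ _~_ k w → Presents _≟′_ _~_ k w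
Presents-≟ {w = w} {_≟_} {_≟′_} P = record
  { count    = λ x → trans (cong length (mapMaybe-cong (m x) w)) (count x)
  ; sound    = λ n e → subst Alternating (sym (mapMaybe-cong (s n) w)) (sound n e)
  ; complete = λ n a → complete n (subst Alternating (mapMaybe-cong (s n) w) a)
  }
  where
  open Presents P
  m : ∀ x z → mono _≟′_ x z ≡ mono _≟_ x z
  m x = mono-unique _≟_ (mono-refl _≟′_ x) (mono-≢ _≟′_)
  s : ∀ {x y} → x ≢ y → ∀ z → side _≟′_ x y z ≡ side _≟_ x y z
  s {x} {y} n = side-unique _≟_ (side-left _≟′_ x y) (side-right _≟′_ n) (side-other _≟′_)

-- Translation between traces and the words of the definitions.

PresentsGraph : (G : Graph) → ℕ → List (V G) → Set
PresentsGraph G = Presents (Graph._≟ᵥ_ G) (Graph._~_ G)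

Presentable : ℕ → Graph → Set
Presentable k G = ∃[ w ] PresentsGraph G k w

module _ {A : Set} (_≟_ : DecidableEquality A) where

  filter-pattern : ∀ x y w →
    filter (λ z → (z ≟ x) ⊎-dec (z ≟ y)) w ≡ map (λ b → if b then x else y) (trace _≟_ x y w)
  filter-pattern x y []      = refl
  filter-pattern x y (z ∷ w) with z ≟ x
  ... | yes refl = cong (z ∷_) (filter-pattern x y w)
  ... | no _ with z ≟ y
  ...   | yes refl = cong (z ∷_) (filter-pattern x y w)
  ...   | no _     = filter-pattern x y w

  length-filter-≟ : ∀ x w → length (filter (x ≟_) w) ≡ (# mono _≟_ x) w
  length-filter-≟ x []      = refl
  length-filter-≟ x (z ∷ w) with x ≟ z | z ≟ x
  ... | yes e    | yes _ = cong suc (length-filter-≟ x w)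
  ... | yes refl | no n  = contradiction refl n
  ... | no n     | yes e = contradiction (sym e) n
  ... | no _     | no _  = length-filter-≟ x w

  #-mono⇒∈ : ∀ x w {k} → (# mono _≟_ x) w ≡ suc k → x ∈ˡ w
  #-mono⇒∈ x (z ∷ w) e with z ≟ x
  ... | yes refl = here refl
  ... | no _     = there (#-mono⇒∈ x w e)

alternating-map : ∀ {A B : Set} (f : A → B) x y n →
  alternating (f x) (f y) n ≡ map f (alternating x y n)
alternating-map f x y zero    = refl
alternating-map f x y (suc n) = cong (f x ∷_) (alternating-map f y x n)

module _ (G : Graph) where
  open Graph G hiding (V)

  -- The restricted word is the image of the trace under `pick`, which is injective because x and y
  -- differ; alternation can be carried through it both ways.
  Alternate⇔ : ∀ w {x y} → x ≢ y → Alternate G w x y ⇔ Alternating (trace _≟ᵥ_ x y w)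
  Alternate⇔ w {x} {y} n = mk⇔ to from
    where
    p = trace _≟ᵥ_ x y w

    pick : Bool → V G
    pick b = if b then x else y

    pick-injective : ∀ {b c} → pick b ≡ pick c → b ≡ c
    pick-injective {true}  {true}  e = refl
    pick-injective {true}  {false} e = contradiction e n
    pick-injective {false} {true}  e = contradiction (sym e) n
    pick-injective {false} {false} e = refl

    back : ∀ b c m → restrict G x y w ≡ alternating (pick b) (pick c) m → p ≡ alternating b c m
    back b c m e = map-injective pick-injective
      (trans (sym (filter-pattern _≟ᵥ_ x y w)) (trans e (alternating-map pick b c m)))

    forth : ∀ b c m → p ≡ alternating b c m → restrict G x y w ≡ alternating (pick b) (pick c) m
    forth b c m e = trans (filter-pattern _≟ᵥ_ x y w)
      (trans (cong (map pick) e) (sym (alternating-map pick b c m)))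

    to : Alternate G w x y → Alternating p
    to (m , inj₁ e) = subst Alternating (sym (back true false m e)) (Alternating-alternating true m)
    to (m , inj₂ e) = subst Alternating (sym (back false true m e)) (Alternating-alternating false m)

    from : Alternating p → Alternate G w x y
    from a with Alternating⇒≡ p a
    ... | m , inj₁ e = m , inj₁ (forth true false m e)
    ... | m , inj₂ e = m , inj₂ (forth false true m e)

  uniformlyRepresentable⇒presentable : ∀ {k} → UniformlyRepresentable G k → Presentable k G
  uniformlyRepresentable⇒presentable (w , uniform , _ , represents) = w , record
    { count    = λ x → trans (sym (length-filter-≟ _≟ᵥ_ x w)) (uniform x)
    ; sound    = λ n e → Equivalence.to (Alternate⇔ w n) (Equivalence.from (represents _ _ n) e)
    ; complete = λ n a → Equivalence.to (represents _ _ n) (Equivalence.from (Alternate⇔ w n) a)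
    }

  -- The positive exponent is what makes every vertex occur in the word, as `Represents` demands.
  presentable⇒uniformlyRepresentable : ∀ {k} → Presentable (suc k) G → UniformlyRepresentable G (suc k)
  presentable⇒uniformlyRepresentable (w , P) = w
    , (λ x → trans (length-filter-≟ _≟ᵥ_ x w) (count x))
    , (λ x → #-mono⇒∈ _≟ᵥ_ x w (count x))
    , λ x y n → mk⇔ (λ a → complete n (Equivalence.to (Alternate⇔ w n) a))
                    (λ e → Equivalence.from (Alternate⇔ w n) (sound n e))
    where open Presents P

-- Induced subgraphs.

-- The partial inverse `from` is part of the data because it is the map applied to words: it erases
-- the letters outside the subgraph and renames the others.
record Embedding (G H : Graph) : Set where
  private
    module G = Graph G
    module H = Graph H
  field
    to        : V G → V H
    from      : V H → Maybe (V G)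
    from-to   : ∀ x → from (to x) ≡ just x
    to-from   : ∀ {x y} → from y ≡ just x → y ≡ to x
    preserves : ∀ {x y} → x G.~ y → to x H.~ to y
    reflects  : ∀ {x y} → to x H.~ to y → x G.~ y

module _ {G H : Graph} (E : Embedding G H) where
  private
    module G = Graph G
    module H = Graph H
  open Embedding E

  to-injective : ∀ {x y} → to x ≡ to y → x ≡ y
  to-injective {x} {y} e with trans (sym (from-to x)) (trans (cong from e) (from-to y))
  ... | refl = refl

  -- Erasing other letters changes neither the counts nor the traces of the remaining ones. With k =
  -- 3 this cuts a word down to a smaller graph; with k = 2, read contrapositively, it carries the
  -- lower bound up.
  Presentable-embedding : ∀ {k} → Presentable k H → Presentable k G
  Presentable-embedding {k} (w , P) = mapMaybe from w , record
    { count    = λ x → trans (cong length (mapMaybe-∘-cong (m x) w)) (count (to x))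
    ; sound    = λ n e → subst Alternating (sym (mapMaybe-∘-cong (s n) w))
                   (sound (n ∘ to-injective) (preserves e))
    ; complete = λ n a → reflects (complete (n ∘ to-injective)
                   (subst Alternating (mapMaybe-∘-cong (s n) w) a))
    }
    where
    open Presents P
    m : ∀ x z → (from z >>= mono G._≟ᵥ_ x) ≡ mono H._≟ᵥ_ (to x) z
    m x = mono-unique H._≟ᵥ_
      (trans (cong (_>>= mono G._≟ᵥ_ x) (from-to x)) (mono-refl G._≟ᵥ_ x)) other
      where
      other : ∀ {z} → z ≢ to x → (from z >>= mono G._≟ᵥ_ x) ≡ nothing
      other {z} n with from z in eq
      ... | nothing = refl
      ... | just v  = mono-≢ G._≟ᵥ_ λ { refl → n (to-from eq) }
    s : ∀ {x y} → x ≢ y → ∀ z → (from z >>= side G._≟ᵥ_ x y) ≡ side H._≟ᵥ_ (to x) (to y) z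
    s {x} {y} n = side-unique H._≟ᵥ_
      (trans (cong (_>>= side G._≟ᵥ_ x y) (from-to x)) (side-left G._≟ᵥ_ x y))
      (trans (cong (_>>= side G._≟ᵥ_ x y) (from-to y)) (side-right G._≟ᵥ_ n)) other
      where
      other : ∀ {z} → z ≢ to x → z ≢ to y → (from z >>= side G._≟ᵥ_ x y) ≡ nothing
      other {z} n m with from z in eq
      ... | nothing = refl
      ... | just v  = side-other G._≟ᵥ_ (λ { refl → n (to-from eq) }) (λ { refl → m (to-from eq) })

-- Lower bound: 2-uniform words as chord diagrams.

module _ {A : Set} (_≟_ : DecidableEquality A) where

  ∈⇒#-mono : ∀ {x w} → x ∈ˡ w → (# mono _≟_ x) w ≢ 0
  ∈⇒#-mono {x} {z ∷ w} (here refl) e rewrite mono-refl _≟_ x = contradiction e λ ()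
  ∈⇒#-mono {x} {z ∷ w} (there i)   e with z ≟ x
  ... | yes _ = contradiction e λ ()
  ... | no _  = ∈⇒#-mono i e

  #-mono-∷ : ∀ x w → (# mono _≟_ x) (x ∷ w) ≡ suc ((# mono _≟_ x) w)
  #-mono-∷ x w rewrite mono-refl _≟_ x = refl

  #-mono-∷-≢ : ∀ {x z} w → z ≢ x → (# mono _≟_ x) (z ∷ w) ≡ (# mono _≟_ x) w
  #-mono-∷-≢ w n rewrite mono-≢ _≟_ n = refl

  #-mono-split : ∀ x w {k} → (# mono _≟_ x) w ≡ suc k →
    ∃[ u ] ∃[ v ] (w ≡ u ++ x ∷ v × (# mono _≟_ x) u ≡ 0 × (# mono _≟_ x) v ≡ k)
  #-mono-split x (z ∷ w) e with z ≟ x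
  ... | yes refl = [] , w , refl , refl , Nat.suc-injective e
  ... | no n with u , v , refl , p , q ← #-mono-split x w e =
    z ∷ u , v , refl , trans (#-mono-∷-≢ u n) p , q

  pattern-absentʳ : ∀ x y w → (# mono _≟_ y) w ≡ 0 →
    trace _≟_ x y w ≡ replicate ((# mono _≟_ x) w) true
  pattern-absentʳ x y []      e = refl
  pattern-absentʳ x y (z ∷ w) e with z ≟ y
  pattern-absentʳ x y (z ∷ w) () | yes _
  ... | no _ with z ≟ x
  ...   | yes _ = cong (true ∷_) (pattern-absentʳ x y w e)
  ...   | no _  = pattern-absentʳ x y w e

  pattern-absentˡ : ∀ x y w → (# mono _≟_ x) w ≡ 0 →
    trace _≟_ x y w ≡ replicate ((# mono _≟_ y) w) false
  pattern-absentˡ x y []      e = refl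
  pattern-absentˡ x y (z ∷ w) e with z ≟ x
  pattern-absentˡ x y (z ∷ w) () | yes _
  ... | no _ with z ≟ y
  ...   | yes _ = cong (false ∷_) (pattern-absentˡ x y w e)
  ...   | no _  = pattern-absentˡ x y w e

-- The word v ∷ S ++ v ∷ T is read as a circle with the chord v, whose two sides
-- are S and T.
module Chords {A : Set} (_≟_ : DecidableEquality A) {_~_ : A → A → Set} (_~?_ : Decidable _~_)
  (~-sym : Symmetric _~_) (~-irrefl : ∀ {x} → ¬ (x ~ x)) where

  private
    count : A → List A → ℕ
    count x = # mono _≟_ x

  Presents₂ : List A → Set
  Presents₂ = Presents _≟_ _~_ 2

  Far : A → A → Set
  Far v x = x ≢ v × ¬ (x ~ v)

  -- Connectedness of the graph without the closed neighbourhood of v, stated as an induction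
  -- principle: a property preserved along edges between far vertices passes from one far vertex to
  -- all of them.
  ConnectedAwayFrom : A → Set₁
  ConnectedAwayFrom v = ∀ (Q : A → Set) →
    (∀ {x y} → Far v x → Far v y → x ~ y → Q x → Q y) →
    ∀ {x y} → Far v x → Far v y → Q x → Q y

  ~⇒≢ : ∀ {x y} → x ~ y → x ≢ y
  ~⇒≢ e refl = ~-irrefl e

  Small : A → List A → Set
  Small v = All (_~ v)

  module Sides {v S T} (P : Presents₂ (v ∷ S ++ v ∷ T)) where
    open Presents P renaming (count to countP)

    count-split : ∀ {x} → x ≢ v → count x S + count x T ≡ 2
    count-split {x} n = trans (sym (trans (#-mono-∷-≢ _≟_ (S ++ v ∷ T) (n ∘ sym))
      (trans (#-++ (mono _≟_ x) S (v ∷ T)) (cong (count x S +_) (#-mono-∷-≢ _≟_ T (n ∘ sym)))))) (countP x)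

    count-v : count v S + count v T ≡ 0
    count-v = Nat.suc-injective (Nat.suc-injective (begin
      suc (suc (count v S + count v T))    ≡⟨ cong suc (Nat.+-suc (count v S) (count v T)) ⟨
      suc (count v S + suc (count v T))    ≡⟨ cong (λ k → suc (count v S + k)) (#-mono-∷ _≟_ v T) ⟨
      suc (count v S + count v (v ∷ T))    ≡⟨ cong suc (#-++ (mono _≟_ v) S (v ∷ T)) ⟨
      suc (count v (S ++ v ∷ T))           ≡⟨ #-mono-∷ _≟_ v (S ++ v ∷ T) ⟨
      count v (v ∷ S ++ v ∷ T)             ≡⟨ countP v ⟩
      2                                    ∎))
      where open ≡-Reasoning

    ∈S⇒≢v : ∀ {x} → x ∈ˡ S → x ≢ v
    ∈S⇒≢v x∈S refl = ∈⇒#-mono _≟_ x∈S (Nat.m+n≡0⇒m≡0 _ count-v)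

    ∈T⇒≢v : ∀ {x} → x ∈ˡ T → x ≢ v
    ∈T⇒≢v x∈T refl = ∈⇒#-mono _≟_ x∈T (Nat.m+n≡0⇒n≡0 (count v S) count-v)

    pattern-sides : ∀ {x} → x ≢ v →
      trace _≟_ v x (v ∷ S ++ v ∷ T) ≡
        true ∷ replicate (count x S) false ++ true ∷ replicate (count x T) false
    pattern-sides {x} n rewrite side-left _≟_ v x = cong (true ∷_)
      (trans (mapMaybe-++ (side _≟_ v x) S (v ∷ T))
        (cong₂ _++_ (pattern-absentˡ _≟_ v x S (Nat.m+n≡0⇒m≡0 _ count-v)) rest))
      where
      rest : trace _≟_ v x (v ∷ T) ≡ true ∷ replicate (count x T) false
      rest rewrite side-left _≟_ v x = cong (true ∷_)
        (pattern-absentˡ _≟_ v x T (Nat.m+n≡0⇒n≡0 (count v S) count-v))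

    -- If both ends of x were on one side, the trace would be v x x v or v v x x, and neither
    -- alternates.
    near : ∀ {x} → x ~ v → count x S ≡ 1 × count x T ≡ 1
    near {x} e with count x S | count x T | count-split (~⇒≢ e) | pattern-sides (~⇒≢ e)
    ... | 0 | 2 | refl | p = ⊥-elim (subst Alternating p (sound (~⇒≢ e ∘ sym) (~-sym e)))
    ... | 1 | 1 | refl | p = refl , refl
    ... | 2 | 0 | refl | p = ⊥-elim (subst Alternating p (sound (~⇒≢ e ∘ sym) (~-sym e)))

    far : ∀ {x} → Far v x → (count x S ≡ 2 × count x T ≡ 0) ⊎ (count x S ≡ 0 × count x T ≡ 2)
    far {x} (n , ¬e) with count x S | count x T | count-split n | pattern-sides n
    ... | 0 | 2 | refl | p = inj₂ (refl , refl)
    ... | 1 | 1 | refl | p = contradiction (~-sym (complete (n ∘ sym) (subst Alternating (sym p) tt))) ¬e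
    ... | 2 | 0 | refl | p = inj₁ (refl , refl)

    -- Both ends of x lie in `S` and both ends of y in `T`, so their trace is x x y y: chords on
    -- different sides of v do not cross.
    separated : ∀ {x y} → Far v x → Far v y → count x S ≡ 2 → count y S ≡ 0 → ¬ (x ~ y)
    separated {x} {y} (n , _) (m , _) p q e = subst Alternating (begin
      trace _≟_ x y (v ∷ S ++ v ∷ T)                     ≡⟨ drop (S ++ v ∷ T) ⟩
      trace _≟_ x y (S ++ v ∷ T)                         ≡⟨ mapMaybe-++ (side _≟_ x y) S (v ∷ T) ⟩
      trace _≟_ x y S ++ trace _≟_ x y (v ∷ T)        ≡⟨ cong₂ _++_ (pattern-absentʳ _≟_ x y S q)
                                                                 (trans (drop T) (pattern-absentˡ _≟_ x y T x∉T)) ⟩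
      replicate (count x S) true ++ replicate (count y T) false
                                                            ≡⟨ cong₂ (λ a b → replicate a true ++ replicate b false) p y∈T ⟩
      true ∷ true ∷ false ∷ false ∷ []                      ∎) (sound (~⇒≢ e) e)
      where
      open ≡-Reasoning
      drop : ∀ w → trace _≟_ x y (v ∷ w) ≡ trace _≟_ x y w
      drop w rewrite side-other _≟_ {x} {y} {v} (n ∘ sym) (m ∘ sym) = refl
      x∉T : count x T ≡ 0
      x∉T = Nat.suc-injective (Nat.suc-injective (trans (sym (cong (_+ count x T) p)) (count-split n)))
      y∈T : count y T ≡ 2
      y∈T = trans (sym (cong (_+ count y T) q)) (count-split m)

    -- If `S` contains an end of some far vertex, then that vertex lies inside `S` altogether. By
    -- `separated` the property of lying inside `S` spreads along edges, hence to all far vertices,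
    -- and only neighbours of v are left for `T`.
    small-side : ConnectedAwayFrom v → Small v S ⊎ Small v T
    small-side connected with All.all? (_~? v) S
    ... | yes small = inj₁ small
    ... | no ¬small with x , x∈S , ¬e ← find (¬All⇒Any¬ (_~? v) S ¬small) = inj₂ (All.tabulate near-T)
      where
      far-x : Far v x
      far-x = ∈S⇒≢v x∈S , ¬e
      inside : ∀ {y} → Far v y → count y S ≡ 2
      inside far-y = connected (λ y → count y S ≡ 2) step far-x far-y start
        where
        start : count x S ≡ 2
        start with far far-x
        ... | inj₁ (p , _) = p
        ... | inj₂ (p , _) = contradiction p (∈⇒#-mono _≟_ x∈S)
        step : ∀ {y z} → Far v y → Far v z → y ~ z → count y S ≡ 2 → count z S ≡ 2
        step fy fz e p with far fz
        ... | inj₁ (q , _) = q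
        ... | inj₂ (q , _) = contradiction e (separated fy fz p q)
      near-T : ∀ {y} → y ∈ˡ T → y ~ v
      near-T {y} y∈T with y ~? v
      ... | yes e = e
      ... | no ¬e with far (∈T⇒≢v y∈T , ¬e)
      ...   | inj₁ (_ , q) = contradiction q (∈⇒#-mono _≟_ y∈T)
      ...   | inj₂ (p , _) = contradiction (trans (sym (inside (∈T⇒≢v y∈T , ¬e))) p) λ ()

  swap-sides : ∀ {v S T} → Presents₂ (v ∷ S ++ v ∷ T) → Presents₂ (v ∷ T ++ v ∷ S)
  swap-sides {v} {S} {T} = Presents-rotate (v ∷ S) (v ∷ T)

  sides : ∀ v {w} → Presents₂ w → ∃[ S ] ∃[ T ] Presents₂ (v ∷ S ++ v ∷ T)
  sides v {w} P
    with A , w′ , refl , _ , p ← #-mono-split _≟_ v w (Presents.count P v)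
    with B , C , refl , _ ← #-mono-split _≟_ v w′ p
    = B , C ++ A , subst Presents₂ (++-assoc (v ∷ B) (v ∷ C) A)
        (Presents-rotate A (v ∷ B ++ v ∷ C) P)

  small-sides : ∀ v → ConnectedAwayFrom v → ∀ {w} → Presents₂ w →
    ∃[ S ] ∃[ T ] (Presents₂ (v ∷ S ++ v ∷ T) × Small v S)
  small-sides v connected P with S , T , Q ← sides v P with Sides.small-side Q connected
  ... | inj₁ small = S , T , Q , small
  ... | inj₂ small = T , S , swap-sides Q , small

  near⇒∈S : ∀ {v S T} → Presents₂ (v ∷ S ++ v ∷ T) → ∀ {x} → x ~ v → x ∈ˡ S
  near⇒∈S {S = S} P {x} e = #-mono⇒∈ _≟_ x S (proj₁ (Sides.near P e))

  -- Three consecutive ends on the small side of the chord v.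
  record Triple (v : A) : Set where
    constructor triple
    field
      {s₁ s₂ s₃} : A
      {S T₁ T₂}  : List A
      presents   : Presents₂ (v ∷ s₁ ∷ s₂ ∷ s₃ ∷ S ++ v ∷ T₁ ++ s₂ ∷ T₂)
      small      : Small v (s₁ ∷ s₂ ∷ s₃ ∷ S)

    near₁ : s₁ ~ v
    near₁ = All.head small

    near₂ : s₂ ~ v
    near₂ = All.head (All.tail small)

    near₃ : s₃ ~ v
    near₃ = All.head (All.tail (All.tail small))

    -- The same circle opened at the chord `s₂`: one side now begins with `s₃`, the other ends with
    -- `s₁`. Whichever side of `s₂` is small gives it a neighbour among these two.
    rotated : Presents₂ (s₂ ∷ (s₃ ∷ S ++ v ∷ T₁) ++ s₂ ∷ T₂ ++ v ∷ s₁ ∷ [])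
    rotated = subst Presents₂ (cong (λ w → s₂ ∷ s₃ ∷ w)
        (trans (++-assoc S _ _) (trans (cong (λ w → S ++ v ∷ w) (++-assoc T₁ _ _)) (sym (++-assoc S _ _)))))
      (Presents-rotate (v ∷ s₁ ∷ []) (s₂ ∷ s₃ ∷ S ++ v ∷ T₁ ++ s₂ ∷ T₂) presents)

  -- Each of the three neighbours has an end on the small side of v. Being distinct they take up at
  -- least three places, and the first three ends there form the triple.
  triples : ∀ {v a b c} → ConnectedAwayFrom v → a ≢ b → a ≢ c → b ≢ c → a ~ v → b ~ v → c ~ v →
    ∀ {w} → Presents₂ w → Triple v
  triples {v} {a} {b} {c} connected a≢b a≢c b≢c a~v b~v c~v P
    with S , T , Q , small ← small-sides v connected P
    with near⇒∈S Q a~v | near⇒∈S Q b~v | near⇒∈S Q c~v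
  ... | i | j | k = go S small Q i j k
    where
    go : ∀ S → Small v S → Presents₂ (v ∷ S ++ v ∷ T) → a ∈ˡ S → b ∈ˡ S → c ∈ˡ S → Triple v
    go (s₁ ∷ []) small Q (here refl) (here e) k = contradiction (sym e) a≢b
    go (s₁ ∷ s₂ ∷ []) small Q (here refl) (here e) k = contradiction (sym e) a≢b
    go (s₁ ∷ s₂ ∷ []) small Q (there (here refl)) (there (here e)) k = contradiction (sym e) a≢b
    go (s₁ ∷ s₂ ∷ []) small Q (here refl) (there (here refl)) (here e) = contradiction (sym e) a≢c
    go (s₁ ∷ s₂ ∷ []) small Q (here refl) (there (here refl)) (there (here e)) = contradiction (sym e) b≢c
    go (s₁ ∷ s₂ ∷ []) small Q (there (here refl)) (here refl) (here e) = contradiction (sym e) b≢c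
    go (s₁ ∷ s₂ ∷ []) small Q (there (here refl)) (here refl) (there (here e)) = contradiction (sym e) a≢c
    go (s₁ ∷ s₂ ∷ s₃ ∷ S) small Q i j k
      -- As a neighbour of v, `s₂` has its second end on the other side, where `T` is now cut.
      with T₁ , T₂ , refl , _ ← #-mono-split _≟_ s₂ T
             (proj₂ (Sides.near {S = s₁ ∷ s₂ ∷ s₃ ∷ S} {T} Q (All.head (All.tail small))))
      = triple Q small

  -- A small side of the middle chord `s₂` contains `s₃` or `s₁`, which is then adjacent to `s₂`
  -- although both are neighbours of v.
  triangle-free⇒⊥ : ∀ v {a b c} → a ≢ b → a ≢ c → b ≢ c → a ~ v → b ~ v → c ~ v →
    ConnectedAwayFrom v → (∀ {x} → x ~ v → ConnectedAwayFrom x) →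
    (∀ {x y} → x ~ v → y ~ v → ¬ (x ~ y)) →
    ∀ {w} → ¬ Presents₂ w
  triangle-free⇒⊥ v a≢b a≢c b≢c a~v b~v c~v connected connected′ free P
    with t ← triples connected a≢b a≢c b≢c a~v b~v c~v P
    with Sides.small-side (Triple.rotated t) (connected′ (Triple.near₂ t))
  ... | inj₁ small = free (Triple.near₃ t) (Triple.near₂ t) (All.head small)
  ... | inj₂ small = free (Triple.near₁ t) (Triple.near₂ t)
                       (All.head (All.tail (proj₂ (++⁻ (Triple.T₂ t) small))))

  not-small : ∀ {v S T x y} → Presents₂ (v ∷ S ++ v ∷ T) → ConnectedAwayFrom v →
    x ∈ˡ S → ¬ (x ~ v) → y ∈ˡ T → ¬ (y ~ v) → ⊥
  not-small P connected x∈S x≁v y∈T y≁v with Sides.small-side P connected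
  ... | inj₁ small = x≁v (All.lookup small x∈S)
  ... | inj₂ small = y≁v (All.lookup small y∈T)

  -- A triangle v i j with a neighbour p of v, and i′ a private neighbour of i.
  -- If i is the middle end on the small side of v, then j and p enclose it and
  -- both sides of the chord j contain an end of one of p and i′.
  module Triangle {v i j p i′ : A} (near-v : ∀ {x} → x ~ v → x ≡ p ⊎ x ≡ i ⊎ x ≡ j)
    (i≢j : i ≢ j) (i≢p : i ≢ p) (j≢p : j ≢ p) (j~v : j ~ v) (p~v : p ~ v) (j~i : j ~ i)
    (p≁i : ¬ (p ~ i)) (p≁j : ¬ (p ~ j)) (i′~i : i′ ~ i) (i′≁v : ¬ (i′ ~ v)) (i′≁j : ¬ (i′ ~ j))
    (connected : ConnectedAwayFrom j) where

    i′≢v : i′ ≢ v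
    i′≢v refl = i′≁j (~-sym j~v)

    i′≢j : i′ ≢ j
    i′≢j refl = i′≁v j~v

    third : ∀ {s} → s ~ v → s ~ i → s ≡ j
    third s~v s~i with near-v s~v
    ... | inj₁ refl        = contradiction s~i p≁i
    ... | inj₂ (inj₁ refl) = contradiction s~i ~-irrefl
    ... | inj₂ (inj₂ q)    = q

    -- Some end of p is on the small side of v. It is not in `S`, which belongs to the small side of
    -- i, so `s₁` is p. The second end of j lies in `T₂`. Opened at j, the circle has an end of i′
    -- on one side, which includes the rest of the small side of i, and an end of p on the other,
    -- although neither is adjacent to j.
    right : ∀ {s₁ S T₁ T₂} → Presents₂ (v ∷ s₁ ∷ i ∷ j ∷ S ++ v ∷ T₁ ++ i ∷ T₂) →
      Small v (s₁ ∷ i ∷ j ∷ S) → Presents₂ (i ∷ (j ∷ S ++ v ∷ T₁) ++ i ∷ T₂ ++ v ∷ s₁ ∷ []) →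
      Small i (j ∷ S ++ v ∷ T₁) → ⊥
    right {s₁} {S} {T₁} {T₂} Q small-v R small-i with near⇒∈S {S = s₁ ∷ i ∷ j ∷ S} Q p~v
    ... | there (here q) = i≢p (sym q)
    ... | there (there (here q)) = j≢p (sym q)
    ... | there (there (there p∈S)) = p≁i (All.lookup small-i (there (∈-++⁺ˡ p∈S)))
    ... | here refl = enclosed (#-mono-split _≟_ j T₂ j∈T₂)
      where
      j∈T₂ : count j T₂ ≡ 1
      j∈T₂ = begin
        count j T₂                              ≡⟨ Nat.+-identityʳ _ ⟨
        count j T₂ + 0                          ≡⟨ cong (count j T₂ +_) (trans (#-mono-∷-≢ _≟_ (p ∷ []) (~⇒≢ j~v ∘ sym))
                                                     (#-mono-∷-≢ _≟_ [] (j≢p ∘ sym))) ⟨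
        count j T₂ + count j (v ∷ p ∷ [])       ≡⟨ #-++ (mono _≟_ j) T₂ (v ∷ p ∷ []) ⟨
        count j (T₂ ++ v ∷ p ∷ [])              ≡⟨ proj₂ (Sides.near {S = j ∷ S ++ v ∷ T₁} R j~i) ⟩
        1                                       ∎
        where open ≡-Reasoning
      assoc : ∀ {T₃ T₄} → (j ∷ S ++ v ∷ T₁ ++ i ∷ T₃ ++ j ∷ T₄) ++ v ∷ p ∷ i ∷ []
        ≡ j ∷ (S ++ v ∷ T₁ ++ i ∷ T₃) ++ j ∷ T₄ ++ v ∷ p ∷ i ∷ []
      assoc {T₃} {T₄} = cong (j ∷_) (trans (++-assoc S _ _) (trans
        (cong (λ w → S ++ v ∷ w) (trans (++-assoc T₁ _ _) (trans
          (cong (λ w → T₁ ++ i ∷ w) (++-assoc T₃ _ _))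
          (sym (++-assoc T₁ _ _)))))
        (sym (++-assoc S _ _))))
      i′∈ : ∀ {T₃} → i′ ∈ˡ (j ∷ S ++ v ∷ T₁) → i′ ∈ˡ (S ++ v ∷ T₁ ++ i ∷ T₃)
      i′∈ (here q) = contradiction q i′≢j
      i′∈ (there m) with ∈-++⁻ S m
      ... | inj₁ m′ = ∈-++⁺ˡ m′
      ... | inj₂ (here q) = contradiction q i′≢v
      ... | inj₂ (there m′) = ∈-++⁺ʳ S (there (∈-++⁺ˡ m′))
      enclosed : ∃[ T₃ ] ∃[ T₄ ] (T₂ ≡ T₃ ++ j ∷ T₄ × count j T₃ ≡ 0 × count j T₄ ≡ 0) → ⊥
      enclosed (T₃ , T₄ , refl , _) =
        not-small (subst Presents₂ assoc (Presents-rotate (v ∷ p ∷ i ∷ []) _ Q)) connected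
          (i′∈ (near⇒∈S {S = j ∷ S ++ v ∷ T₁} R i′~i)) i′≁j
          (∈-++⁺ʳ T₄ (there (here refl))) p≁j

    -- Here j precedes i, so the end of p on the small side of v lies in `S`. The crossing of j and
    -- i puts the second end of j into `T₁`. Then p has an end on one side of j and i′, through its
    -- end in `T₂`, on the other.
    left : ∀ {S T₁ T₂} → Presents₂ (v ∷ j ∷ i ∷ S ++ v ∷ T₁ ++ i ∷ T₂) →
      Presents₂ (i ∷ (S ++ v ∷ T₁) ++ i ∷ T₂ ++ v ∷ j ∷ []) → ⊥
    left {S} {T₁} {T₂} Q R with near⇒∈S {S = j ∷ i ∷ S} Q p~v
    ... | here q = j≢p (sym q)
    ... | there (here q) = i≢p (sym q)
    ... | there (there p∈S) = enclosed (#-mono-split _≟_ j T₁ j∈T₁)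
      where
      j∉S : count j S ≡ 0
      j∉S = Nat.suc-injective (begin
        suc (count j S)        ≡⟨ cong suc (#-mono-∷-≢ _≟_ S i≢j) ⟨
        suc (count j (i ∷ S))  ≡⟨ #-mono-∷ _≟_ j (i ∷ S) ⟨
        count j (j ∷ i ∷ S)    ≡⟨ proj₁ (Sides.near {S = j ∷ i ∷ S} Q j~v) ⟩
        1                      ∎)
        where open ≡-Reasoning
      j∈T₁ : count j T₁ ≡ 1
      j∈T₁ = begin
        count j T₁                   ≡⟨ cong (_+ count j T₁) j∉S ⟨
        count j S + count j T₁       ≡⟨ cong (count j S +_) (#-mono-∷-≢ _≟_ T₁ (~⇒≢ j~v ∘ sym)) ⟨
        count j S + count j (v ∷ T₁) ≡⟨ #-++ (mono _≟_ j) S (v ∷ T₁) ⟨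
        count j (S ++ v ∷ T₁)        ≡⟨ proj₁ (Sides.near {S = S ++ v ∷ T₁} R j~i) ⟩
        1                            ∎
        where open ≡-Reasoning
      assoc : ∀ {T₃ T₄} → (j ∷ i ∷ S ++ v ∷ (T₃ ++ j ∷ T₄) ++ i ∷ T₂) ++ v ∷ []
        ≡ j ∷ (i ∷ S ++ v ∷ T₃) ++ j ∷ T₄ ++ i ∷ T₂ ++ v ∷ []
      assoc {T₃} {T₄} = cong (λ w → j ∷ i ∷ w) (trans (++-assoc S _ _) (trans
        (cong (λ w → S ++ v ∷ w) (trans (++-assoc (T₃ ++ j ∷ T₄) _ _) (++-assoc T₃ _ _)))
        (sym (++-assoc S _ _))))
      i′∈ : i′ ∈ˡ (T₂ ++ v ∷ j ∷ []) → i′ ∈ˡ (T₂ ++ v ∷ [])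
      i′∈ m with ∈-++⁻ T₂ m
      ... | inj₁ m′ = ∈-++⁺ˡ m′
      ... | inj₂ (here q) = contradiction q i′≢v
      ... | inj₂ (there (here q)) = contradiction q i′≢j
      enclosed : ∃[ T₃ ] ∃[ T₄ ] (T₁ ≡ T₃ ++ j ∷ T₄ × count j T₃ ≡ 0 × count j T₄ ≡ 0) → ⊥
      enclosed (T₃ , T₄ , refl , _) =
        not-small (subst Presents₂ assoc (Presents-rotate (v ∷ []) _ Q)) connected
          (there (∈-++⁺ˡ p∈S)) p≁j
          (∈-++⁺ʳ T₄ (there (i′∈ (near⇒∈S (swap-sides {S = S ++ v ∷ T₁} R) i′~i)))) i′≁j

    middle : ∀ {s₁ s₃ S T₁ T₂} → Presents₂ (v ∷ s₁ ∷ i ∷ s₃ ∷ S ++ v ∷ T₁ ++ i ∷ T₂) →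
      Small v (s₁ ∷ i ∷ s₃ ∷ S) → Presents₂ (i ∷ (s₃ ∷ S ++ v ∷ T₁) ++ i ∷ T₂ ++ v ∷ s₁ ∷ []) →
      ConnectedAwayFrom i → ⊥
    middle {s₁} {s₃} {S} {T₁} {T₂} Q small@(s₁~v ∷ _ ∷ s₃~v ∷ _) R connected-i
      with Sides.small-side {S = s₃ ∷ S ++ v ∷ T₁} R connected-i
    ... | inj₁ small-i with refl ← third s₃~v (All.head small-i) = right Q small R small-i
    ... | inj₂ small-i
      with refl ← third s₁~v (All.head (All.tail (proj₂ (++⁻ T₂ small-i)))) = left {S = s₃ ∷ S} Q R

  -- The middle end of the triple is a, b or p. The first two are handled by `Triangle.middle`, with
  -- the roles of a and b exchanged. For p, a small side would contain a common neighbour of p and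
  -- v, and there is none.
  triangle⇒⊥ : ∀ v {p a b a′ b′} → a ≢ b → a ≢ p → b ≢ p → a ~ v → b ~ v → p ~ v → a ~ b →
    (∀ {x} → x ~ v → x ≡ p ⊎ x ≡ a ⊎ x ≡ b) → ¬ (p ~ a) → ¬ (p ~ b) →
    a′ ~ a → ¬ (a′ ~ v) → ¬ (a′ ~ b) → b′ ~ b → ¬ (b′ ~ v) → ¬ (b′ ~ a) →
    ConnectedAwayFrom v → ConnectedAwayFrom p → ConnectedAwayFrom a → ConnectedAwayFrom b →
    ∀ {w} → ¬ Presents₂ w
  triangle⇒⊥ v {p} {a} {b} a≢b a≢p b≢p a~v b~v p~v a~b near-v p≁a p≁b
    a′~a a′≁v a′≁b b′~b b′≁v b′≁a conn-v conn-p conn-a conn-b P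
    with triples conn-v a≢b a≢p b≢p a~v b~v p~v P
  ... | t@(triple {s₁} {s₂} {s₃} {S} {T₁} {T₂} Q small) with near-v (Triple.near₂ t)
  ...   | inj₂ (inj₁ refl) = Triangle.middle near-v a≢b a≢p b≢p b~v p~v (~-sym a~b) p≁a p≁b
                               a′~a a′≁v a′≁b conn-b Q small (Triple.rotated t) conn-a
  ...   | inj₂ (inj₂ refl) = Triangle.middle near-v′ (a≢b ∘ sym) b≢p a≢p a~v p~v a~b p≁b p≁a
                               b′~b b′≁v b′≁a conn-a Q small (Triple.rotated t) conn-b
    where
    near-v′ : ∀ {x} → x ~ v → x ≡ p ⊎ x ≡ b ⊎ x ≡ a
    near-v′ e with near-v e
    ... | inj₁ q        = inj₁ q
    ... | inj₂ (inj₁ q) = inj₂ (inj₂ q)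
    ... | inj₂ (inj₂ q) = inj₂ (inj₁ q)
  ...   | inj₁ refl = contradiction (Sides.small-side {S = s₃ ∷ S ++ v ∷ T₁} (Triple.rotated t) conn-p) λ
    { (inj₁ small-p) → isolated (Triple.near₃ t) (All.head small-p)
    ; (inj₂ small-p) → isolated (Triple.near₁ t) (All.head (All.tail (proj₂ (++⁻ T₂ small-p))))
    }
    where
    isolated : ∀ {s} → s ~ v → ¬ (s ~ p)
    isolated e f with near-v e
    ... | inj₁ refl        = ~-irrefl f
    ... | inj₂ (inj₁ refl) = p≁a (~-sym f)
    ... | inj₂ (inj₂ refl) = p≁b (~-sym f)

-- Upper bound: joining two vertices by a path of length 3.

isAlternating-not : ∀ p → isAlternating (map not p) ≡ isAlternating p
isAlternating-not []          = refl
isAlternating-not (b ∷ p)     = from (not b) p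
  where
  from : ∀ b p → alternatesFrom (not b) (map not p) ≡ alternatesFrom b p
  from b     []          = refl
  from true  (true  ∷ p) = from false p
  from true  (false ∷ p) = refl
  from false (true  ∷ p) = refl
  from false (false ∷ p) = from true p

module _ {A : Set} (_≟_ : DecidableEquality A) where

  pattern-swap : ∀ {x y} → x ≢ y → ∀ w → trace _≟_ y x w ≡ map not (trace _≟_ x y w)
  pattern-swap n []      = refl
  pattern-swap {x} {y} n (z ∷ w) with z ≟ x | z ≟ y
  ... | yes refl | yes refl = contradiction refl n
  ... | yes _    | no _     = cong (false ∷_) (pattern-swap n w)
  ... | no _     | yes _    = cong (true ∷_) (pattern-swap n w)
  ... | no _     | no _     = pattern-swap n w

  Alternating-swap : ∀ {x y} → x ≢ y → ∀ w → Alternating (trace _≟_ x y w) → Alternating (trace _≟_ y x w)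
  Alternating-swap n w = subst T (sym (trans (cong isAlternating (pattern-swap n w))
    (isAlternating-not (trace _≟_ _ _ w))))

  side≡true⇒≡ : ∀ {x y z} → side _≟_ x y z ≡ just true → z ≡ x
  side≡true⇒≡ {x} {y} {z} e with z ≟ x
  ... | yes q = q
  ... | no _ with z ≟ y
  side≡true⇒≡ () | no _ | yes _
  side≡true⇒≡ () | no _ | no _

  side≡false⇒≡ : ∀ {x y z} → side _≟_ x y z ≡ just false → z ≡ y
  side≡false⇒≡ {x} {y} {z} e with z ≟ x
  side≡false⇒≡ () | yes _
  ... | no _ with z ≟ y
  ... | yes q = q
  side≡false⇒≡ () | no _ | no _

-- Lifts a position chosen in a trace to a position in the word itself, where the new letters are to
-- be written.
mapMaybe-split : ∀ {A B : Set} (h : A → Maybe B) w {p b q} → mapMaybe h w ≡ p ++ b ∷ q →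
  ∃[ u ] ∃[ z ] ∃[ v ] (w ≡ u ++ z ∷ v × mapMaybe h u ≡ p × h z ≡ just b × mapMaybe h v ≡ q)
mapMaybe-split h [] {[]} ()
mapMaybe-split h [] {_ ∷ _} ()
mapMaybe-split h (z ∷ w) {p} e with h z in hz
mapMaybe-split h (z ∷ w) {[]}    refl | just b = [] , z , w , refl , refl , hz , refl
mapMaybe-split h (z ∷ w) {c ∷ p} e | just b
  with refl , e′ ← ∷-injective e
  with u , y , v , refl , a , s , t ← mapMaybe-split h w e′
  = z ∷ u , y , v , refl , keep , s , t
  where
  keep : mapMaybe h (z ∷ u) ≡ c ∷ p
  keep rewrite hz = cong (c ∷_) a
mapMaybe-split h (z ∷ w) {p} e | nothing
  with u , y , v , refl , a , s , t ← mapMaybe-split h w e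
  = z ∷ u , y , v , refl , drop , s , t
  where
  drop : mapMaybe h (z ∷ u) ≡ p
  drop rewrite hz = a

module _ (G N : Graph) where
  private
    module G = Graph G
    module N = Graph N

  _≟ₛ_ : DecidableEquality (V G ⊎ V N)
  _≟ₛ_ = ≡-dec G._≟ᵥ_ N._≟ᵥ_

  -- Erasing the new letters leaves the traces of old pairs unchanged, so these are settled by the
  -- old word. What remains to be checked are the counts of new letters and the pairs that contain
  -- one.
  glue-presents : ∀ {L : REL (V G) (V N) 0ℓ} {L? : Decidable L} {k} w′ → PresentsGraph G k (mapMaybe isInj₁ w′) →
    (∀ i → (# mono _≟ₛ_ (inj₂ i)) w′ ≡ k) →
    (∀ i a → Alternating (trace _≟ₛ_ (inj₂ i) (inj₁ a) w′) ⇔ L a i) →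
    (∀ {i j} → i ≢ j → Alternating (trace _≟ₛ_ (inj₂ i) (inj₂ j) w′) ⇔ i N.~ j) →
    PresentsGraph (glue G N L L?) k w′
  glue-presents {L} {L?} {k} w′ P new mixed news = Presents-≟ {_≟_ = _≟ₛ_} record
    { count    = λ { (inj₁ a) → trans (sym (cong length (mapMaybe-∘-cong (m a) w′))) (count a) ; (inj₂ i) → new i }
    ; sound    = sound′ _ _
    ; complete = complete′ _ _
    }
    where
    open Presents P
    m : ∀ a z → (isInj₁ z >>= mono G._≟ᵥ_ a) ≡ mono _≟ₛ_ (inj₁ a) z
    m a = mono-unique _≟ₛ_ (mono-refl G._≟ᵥ_ a) λ
      { {inj₁ z} n → mono-≢ G._≟ᵥ_ (n ∘ cong inj₁) ; {inj₂ z} n → refl }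
    s : ∀ {a b} → a ≢ b → ∀ z → (isInj₁ z >>= side G._≟ᵥ_ a b) ≡ side _≟ₛ_ (inj₁ a) (inj₁ b) z
    s {a} {b} n = side-unique _≟ₛ_ (side-left G._≟ᵥ_ a b) (side-right G._≟ᵥ_ n) λ
      { {inj₁ z} p q → side-other G._≟ᵥ_ (p ∘ cong inj₁) (q ∘ cong inj₁) ; {inj₂ z} p q → refl }
    sound′ : ∀ x y → x ≢ y → Graph._~_ (glue G N L L?) x y → Alternating (trace _≟ₛ_ x y w′)
    sound′ (inj₁ a) (inj₁ b) n e = subst Alternating (mapMaybe-∘-cong (s (n ∘ cong inj₁)) w′) (sound (n ∘ cong inj₁) e)
    sound′ (inj₂ i) (inj₁ a) n e = Equivalence.from (mixed i a) e
    sound′ (inj₁ a) (inj₂ i) n e = Alternating-swap _≟ₛ_ (n ∘ sym) w′ (Equivalence.from (mixed i a) e)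
    sound′ (inj₂ i) (inj₂ j) n e = Equivalence.from (news (n ∘ cong inj₂)) e
    complete′ : ∀ x y → x ≢ y → Alternating (trace _≟ₛ_ x y w′) → Graph._~_ (glue G N L L?) x y
    complete′ (inj₁ a) (inj₁ b) n e = complete (n ∘ cong inj₁)
      (subst Alternating (sym (mapMaybe-∘-cong (s (n ∘ cong inj₁)) w′)) e)
    complete′ (inj₂ i) (inj₁ a) n e = Equivalence.to (mixed i a) e
    complete′ (inj₁ a) (inj₂ i) n e = Equivalence.to (mixed i a) (Alternating-swap _≟ₛ_ n w′ e)
    complete′ (inj₂ i) (inj₂ j) n e = Equivalence.to (news (n ∘ cong inj₂)) e

-- The new letters u and v are zero and suc zero; in patterns, x is true and y
-- is false.
insertion : Bool → ∀ {A : Set} → A → List (A ⊎ Fin 2)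
insertion true  x = inj₂ zero ∷ inj₁ x ∷ inj₂ (suc zero) ∷ inj₂ zero ∷ []
insertion false y = inj₂ (suc zero) ∷ inj₁ y ∷ inj₂ zero ∷ inj₂ (suc zero) ∷ []

insert : ∀ {A : Set} (p : List A) (b : Bool) (x : A) (q : List A) (c : Bool) (y : A) (r : List A) → List (A ⊎ Fin 2)
insert p b x q c y r = map inj₁ p ++ insertion b x ++ map inj₁ q ++ insertion c y ++ map inj₁ r

_≟ₚ_ : DecidableEquality (Bool ⊎ Fin 2)
_≟ₚ_ = ≡-dec Bool._≟_ Fin._≟_

-- The demands on u and v against x, y and each other. They involve four letters only and are
-- therefore decidable on the pattern; the remaining old letters are excluded by `new-other`.
Joins : List (Bool ⊎ Fin 2) → Set
Joins w = (∀ i → (# mono _≟ₚ_ (inj₂ i)) w ≡ 3)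
  × Alternating (trace _≟ₚ_ u x w)
  × ¬ Alternating (trace _≟ₚ_ u y w)
  × ¬ Alternating (trace _≟ₚ_ v x w)
  × Alternating (trace _≟ₚ_ v y w)
  × Alternating (trace _≟ₚ_ u v w)
  where
  u v x y : Bool ⊎ Fin 2
  u = inj₂ zero
  v = inj₂ (suc zero)
  x = inj₁ true
  y = inj₁ false

joins? : ∀ w → Dec (Joins w)
joins? w = Fin.all? (λ i → (# mono _≟ₚ_ (inj₂ i)) w Nat.≟ 3)
  ×-dec T? _ ×-dec ¬? (T? _) ×-dec ¬? (T? _) ×-dec T? _ ×-dec T? _

splits : (p : List Bool) → List (∃[ q ] ∃[ b ] ∃[ r ] p ≡ q ++ b ∷ r)
splits []      = []
splits (b ∷ p) = ([] , b , p , refl) ∷ map (λ (q , c , r , e) → b ∷ q , c , r , cong (b ∷_) e) (splits p)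

Joinable : List Bool → Set
Joinable p = ∃[ q ] ∃[ b ] ∃[ r ] ∃[ s ]
  (p ≡ q ++ b ∷ r ++ not b ∷ s × Joins (insert q b b r (not b) (not b) s))

isJoinable : List Bool → Bool
isJoinable p = any (λ (q , b , r , _) → any (λ (r′ , c , s , _) →
  ⌊ c Bool.≟ not b ×-dec joins? (insert q b b r′ c c s) ⌋) (splits r)) (splits p)

isJoinable⇒Joinable : ∀ p → T (isJoinable p) → Joinable p
isJoinable⇒Joinable p t
  with (q , b , r , refl) , t′ ← Any.satisfied (any⁻ _ (splits p) t)
  with (r′ , c , s , refl) , t″ ← Any.satisfied (any⁻ _ (splits r) t′)
  with refl , j ← toWitness {a? = c Bool.≟ not b ×-dec joins? (insert q b b r′ c c s)} t″
  = q , b , r′ , s , refl , j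

-- A quantifier over patterns with given counts, as a Boolean. A single `tt` then covers the 20
-- patterns with counts 3 and 3 in `joinable`, and those with counts at most 1 in `Three⇒ℛ₃`.
everyPattern : ℕ → ℕ → (List Bool → Bool) → Bool
everyPattern zero    zero    f = f []
everyPattern zero    (suc n) f = everyPattern zero n (f ∘ (false ∷_))
everyPattern (suc m) zero    f = everyPattern m zero (f ∘ (true ∷_))
everyPattern (suc m) (suc n) f = everyPattern m (suc n) (f ∘ (true ∷_)) ∧ everyPattern (suc m) n (f ∘ (false ∷_))

everyPattern-sound : ∀ m n f → T (everyPattern m n f) →
  ∀ p → (# only true) p ≡ m → (# only false) p ≡ n → T (f p)
everyPattern-sound zero    zero    f t []          _    _    = t
everyPattern-sound zero    zero    f t (true ∷ p)  ()   _
everyPattern-sound zero    zero    f t (false ∷ p) _    ()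
everyPattern-sound zero    (suc n) f t (false ∷ p) e    refl = everyPattern-sound zero n _ t p e refl
everyPattern-sound (suc m) zero    f t (true ∷ p)  refl e    = everyPattern-sound m zero _ t p refl e
everyPattern-sound (suc m) (suc n) f t (true ∷ p)  refl e    =
  everyPattern-sound m (suc n) _ (proj₁ (Equivalence.to Bool.T-∧ t)) p refl e
everyPattern-sound (suc m) (suc n) f t (false ∷ p) e    refl =
  everyPattern-sound (suc m) n _ (proj₂ (Equivalence.to (Bool.T-∧ {everyPattern m (suc n) _}) t)) p e refl

joinable : ∀ p → (# only true) p ≡ 3 → (# only false) p ≡ 3 → Joinable p
joinable p e f = isJoinable⇒Joinable p (everyPattern-sound 3 3 isJoinable tt p e f)

doubled⇒¬Alternating : ∀ {A : Set} (h : A → Maybe Bool) {z} u v w → h z ≡ just true →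
  mapMaybe h v ≡ [] → ¬ Alternating (mapMaybe h (u ++ z ∷ v ++ z ∷ w))
doubled⇒¬Alternating h {z} u v w e f a
  with a′ ← Alternating-++ʳ (mapMaybe h u) _ (subst Alternating (mapMaybe-++ h u _) a)
  rewrite e | mapMaybe-++ h v (z ∷ w) | f | e = a′

module Join (G : Graph) {x y : V G} (x≢y : x ≢ y) where
  private
    module G = Graph G

  letter : Bool → V G
  letter b = if b then x else y

  side≡letter : ∀ {b z} → side G._≟ᵥ_ x y z ≡ just b → z ≡ letter b
  side≡letter {true}  = side≡true⇒≡ G._≟ᵥ_
  side≡letter {false} = side≡false⇒≡ G._≟ᵥ_

  private
    _≟_ = _≟ₛ_ G (path 2)

    u v : V G ⊎ Fin 2
    u = inj₂ zero
    v = inj₂ (suc zero)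

    -- κ forgets the old letters other than x and y.
    κ : V G ⊎ Fin 2 → Maybe (Bool ⊎ Fin 2)
    κ (inj₁ a) = Maybe.map inj₁ (side G._≟ᵥ_ x y a)
    κ (inj₂ i) = just (inj₂ i)

    κ-letter : ∀ b → κ (inj₁ (letter b)) ≡ just (inj₁ b)
    κ-letter true  = cong (Maybe.map inj₁) (side-left G._≟ᵥ_ x y)
    κ-letter false = cong (Maybe.map inj₁) (side-right G._≟ᵥ_ x≢y)

    κ-map : ∀ w → mapMaybe κ (map inj₁ w) ≡ map inj₁ (mapMaybe (side G._≟ᵥ_ x y) w)
    κ-map []      = refl
    κ-map (z ∷ w) with side G._≟ᵥ_ x y z
    ... | just b  = cong (inj₁ b ∷_) (κ-map w)
    ... | nothing = κ-map w

    κ-insertion : ∀ b w → mapMaybe κ (insertion b (letter b) ++ w) ≡ insertion b b ++ mapMaybe κ w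
    κ-insertion true  w rewrite κ-letter true  = refl
    κ-insertion false w rewrite κ-letter false = refl

    erase-insertion : ∀ b {a : V G} w → mapMaybe isInj₁ (insertion b a ++ w) ≡ a ∷ mapMaybe isInj₁ w
    erase-insertion true  w = refl
    erase-insertion false w = refl

  module _ (A B C : List (V G)) (b c : Bool) where

    inserted : List (V G ⊎ Fin 2)
    inserted = insert A b (letter b) B c (letter c) C

    private
      pat : List (V G) → List Bool
      pat = mapMaybe (side G._≟ᵥ_ x y)

    -- Through `κ` the inserted word becomes the word over four letters that `joinable` has tested.
    κ-inserted : mapMaybe κ inserted ≡ insert (pat A) b b (pat B) c c (pat C)
    κ-inserted = begin
      mapMaybe κ inserted ≡⟨ mapMaybe-++ κ (map inj₁ A) _ ⟩
      mapMaybe κ (map inj₁ A) ++ mapMaybe κ (insertion b (letter b) ++ map inj₁ B ++ insertion c (letter c) ++ map inj₁ C)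
        ≡⟨ cong₂ _++_ (κ-map A) (trans (κ-insertion b _) (cong (insertion b b ++_) (trans (mapMaybe-++ κ (map inj₁ B) _)
           (cong₂ _++_ (κ-map B) (trans (κ-insertion c _) (cong (insertion c c ++_) (κ-map C))))))) ⟩
      insert (pat A) b b (pat B) c c (pat C) ∎
      where open ≡-Reasoning

    erase-map : ∀ (w : List (V G)) z → mapMaybe isInj₁ (map inj₁ w ++ z) ≡ w ++ mapMaybe {B = V G} (isInj₁ {B = Fin 2}) z
    erase-map []      z = refl
    erase-map (a ∷ w) z = cong (a ∷_) (erase-map w z)

    erase-inserted : mapMaybe isInj₁ inserted ≡ A ++ letter b ∷ B ++ letter c ∷ C
    erase-inserted = trans (erase-map A _) (cong (A ++_) (trans (erase-insertion b _) (cong (letter b ∷_)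
      (trans (erase-map B _) (cong (B ++_) (trans (erase-insertion c _) (cong (letter c ∷_)
        (mapMaybeIsInj₁∘mapInj₁ C))))))))

  private
    new : Bool → Fin 2
    new true  = zero
    new false = suc zero

    -- The insertion writes `new b` twice with only `letter b` and the other new letter in between.
    -- An old letter a other than x and y does not separate the two copies, so the trace has a
    -- repetition.
    new-doubled : ∀ b {a} → a ≢ x → a ≢ y → ∀ p q →
      ¬ Alternating (trace _≟_ (inj₂ (new b)) (inj₁ a) (p ++ insertion b (letter b) ++ q))
    new-doubled true {a} n m p q = doubled⇒¬Alternating (side _≟_ u (inj₁ a)) p (inj₁ x ∷ v ∷ []) q refl silent
      where
      silent : mapMaybe (side _≟_ u (inj₁ a)) (inj₁ x ∷ v ∷ []) ≡ []
      silent rewrite side-other _≟_ {x = u} {y = inj₁ a} {z = inj₁ x} (λ ()) (n ∘ sym ∘ inj₁-injective) = refl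
    new-doubled false {a} n m p q = doubled⇒¬Alternating (side _≟_ v (inj₁ a)) p (inj₁ y ∷ u ∷ []) q refl silent
      where
      silent : mapMaybe (side _≟_ v (inj₁ a)) (inj₁ y ∷ u ∷ []) ≡ []
      silent rewrite side-other _≟_ {x = v} {y = inj₁ a} {z = inj₁ y} (λ ()) (m ∘ sym ∘ inj₁-injective) = refl

    new-other : ∀ {A B C} b i {a} → a ≢ x → a ≢ y →
      ¬ Alternating (trace _≟_ (inj₂ i) (inj₁ a) (inserted A B C b (not b)))
    new-other {A} {B} {C} b i {a} n m = go b i
      where
      assoc : ∀ b → inserted A B C b (not b)
        ≡ (map inj₁ A ++ insertion b (letter b) ++ map inj₁ B) ++ insertion (not b) (letter (not b)) ++ map inj₁ C
      assoc b = trans (cong (map inj₁ A ++_) (sym (++-assoc (insertion b (letter b)) (map inj₁ B) _)))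
        (sym (++-assoc (map inj₁ A) _ _))
      second : ∀ b → ¬ Alternating (trace _≟_ (inj₂ (new (not b))) (inj₁ a) (inserted A B C b (not b)))
      second b t = new-doubled (not b) n m (map inj₁ A ++ insertion b (letter b) ++ map inj₁ B) _
        (subst (Alternating ∘ trace _≟_ (inj₂ (new (not b))) (inj₁ a)) (assoc b) t)
      go : ∀ b i → ¬ Alternating (trace _≟_ (inj₂ i) (inj₁ a) (inserted A B C b (not b)))
      go true  zero       = new-doubled true n m (map inj₁ A) _
      go true  (suc zero) = second true
      go false zero       = second false
      go false (suc zero) = new-doubled false n m (map inj₁ A) _

    via-κ : ∀ {s t} {s′ t′} → κ s ≡ just s′ → κ t ≡ just t′ → s′ ≢ t′ →
      (∀ {z z′} → κ z ≡ just z′ → (z′ ≡ s′ → z ≡ s) × (z′ ≡ t′ → z ≡ t)) →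
      ∀ w → trace _≟ₚ_ s′ t′ (mapMaybe κ w) ≡ trace _≟_ s t w
    via-κ {s} {t} {s′} {t′} p q n inj w = mapMaybe-∘-cong (side-unique _≟_ at-s at-t other) w
      where
      at-s : (κ s >>= side _≟ₚ_ s′ t′) ≡ just true
      at-s rewrite p = side-left _≟ₚ_ s′ t′
      at-t : (κ t >>= side _≟ₚ_ s′ t′) ≡ just false
      at-t rewrite q = side-right _≟ₚ_ n
      other : ∀ {z} → z ≢ s → z ≢ t → (κ z >>= side _≟ₚ_ s′ t′) ≡ nothing
      other {z} f g with κ z in e
      ... | nothing = refl
      ... | just z′ = side-other _≟ₚ_ (f ∘ proj₁ (inj e)) (g ∘ proj₂ (inj e))

    κ-injective : ∀ {z s z′ s′} → κ z ≡ just z′ → κ s ≡ just s′ → z′ ≡ s′ → z ≡ s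
    κ-injective {inj₁ a} {inj₁ c} e f refl with side G._≟ᵥ_ x y a in p | side G._≟ᵥ_ x y c in q
    κ-injective refl refl refl | just b | just b = cong inj₁ (trans (side≡letter p) (sym (side≡letter q)))
    κ-injective {inj₁ a} {inj₂ j} e refl refl with side G._≟ᵥ_ x y a
    κ-injective () refl refl | just b
    κ-injective () refl refl | nothing
    κ-injective {inj₂ i} {inj₁ c} refl f refl with side G._≟ᵥ_ x y c
    κ-injective refl () refl | just b
    κ-injective refl () refl | nothing
    κ-injective {inj₂ i} {inj₂ j} refl refl refl = refl

    pattern-κ : ∀ {s t s′ t′} → κ s ≡ just s′ → κ t ≡ just t′ → s′ ≢ t′ →
      ∀ w → trace _≟ₚ_ s′ t′ (mapMaybe κ w) ≡ trace _≟_ s t w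
    pattern-κ p q n = via-κ p q n λ e → (λ f → κ-injective e p f) , (λ f → κ-injective e q f)

    mono-κ : ∀ {s s′} → κ s ≡ just s′ → ∀ w → (# mono _≟ₚ_ s′) (mapMaybe κ w) ≡ (# mono _≟_ s) w
    mono-κ {s} {s′} p w = cong length (mapMaybe-∘-cong (mono-unique _≟_ at other) w)
      where
      at : (κ s >>= mono _≟ₚ_ s′) ≡ just tt
      at rewrite p = mono-refl _≟ₚ_ s′
      other : ∀ {z} → z ≢ s → (κ z >>= mono _≟ₚ_ s′) ≡ nothing
      other {z} f with κ z in e
      ... | nothing = refl
      ... | just z′ = mono-≢ _≟ₚ_ (f ∘ κ-injective e p)

  join-presentable : Presentable 3 G → Presentable 3 (joinByPath G x y 3)
  join-presentable (w , P)
    with q , b , r , s , e , joins ← joinable (trace G._≟ᵥ_ x y w)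
           (trans (#-true G._≟ᵥ_ x y w) (Presents.count P x))
           (trans (#-false G._≟ᵥ_ x≢y w) (Presents.count P y))
    -- The two positions found in the pattern are lifted to the word one after the other; the
    -- Boolean b records whether the chosen x comes before the chosen y.
    with A , _ , w′ , refl , refl , b≡ , e′ ← mapMaybe-split (side G._≟ᵥ_ x y) w e
    with B , _ , C , refl , refl , c≡ , refl ← mapMaybe-split (side G._≟ᵥ_ x y) w′ e′
    with refl ← side≡letter b≡ | refl ← side≡letter c≡
    = w″ , glue-presents G (path 2) {L? = λ a i → Graph._~?_ (joinByPath G x y 3) (inj₁ a) (inj₂ i)} w″
        (subst (PresentsGraph G 3) (sym (erase-inserted A B C b (not b))) P) new-count mixed news
    where
    w″ = inserted A B C b (not b)
    joins′ : Joins (mapMaybe κ w″)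
    joins′ = subst Joins (sym (κ-inserted A B C b (not b))) joins
    κx = κ-letter true
    κy = κ-letter false
    new-count : ∀ i → (# mono _≟_ (inj₂ i)) w″ ≡ 3
    new-count i = trans (sym (mono-κ {inj₂ i} refl w″)) (proj₁ joins′ i)
    via : ∀ {s t s′ t′} → κ s ≡ just s′ → κ t ≡ just t′ → s′ ≢ t′ →
      Alternating (trace _≟ₚ_ s′ t′ (mapMaybe κ w″)) → Alternating (trace _≟_ s t w″)
    via p q n = subst Alternating (pattern-κ p q n w″)
    via⁻¹ : ∀ {s t s′ t′} → κ s ≡ just s′ → κ t ≡ just t′ → s′ ≢ t′ →
      Alternating (trace _≟_ s t w″) → Alternating (trace _≟ₚ_ s′ t′ (mapMaybe κ w″))
    via⁻¹ p q n = subst Alternating (sym (pattern-κ p q n w″))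
    at-x : ∀ i → Alternating (trace _≟_ (inj₂ i) (inj₁ x) w″) → toℕ i ≡ 0
    at-x zero       t = refl
    at-x (suc zero) t = ⊥-elim (proj₁ (proj₂ (proj₂ (proj₂ joins′))) (via⁻¹ refl κx (λ ()) t))
    at-y : ∀ i → Alternating (trace _≟_ (inj₂ i) (inj₁ y) w″) → suc (toℕ i) ≡ 2
    at-y zero       t = ⊥-elim (proj₁ (proj₂ (proj₂ joins′)) (via⁻¹ refl κy (λ ()) t))
    at-y (suc zero) t = refl
    mixed : ∀ i a → Alternating (trace _≟_ (inj₂ i) (inj₁ a) w″) ⇔
      ((a ≡ x × toℕ i ≡ 0) ⊎ (a ≡ y × suc (toℕ i) ≡ 2))
    mixed i a = mk⇔ to from
      where
      from : (a ≡ x × toℕ i ≡ 0) ⊎ (a ≡ y × suc (toℕ i) ≡ 2) → Alternating (trace _≟_ (inj₂ i) (inj₁ a) w″)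
      from (inj₁ (refl , e)) with refl ← Fin.toℕ-injective {i = i} {zero} e =
        via refl κx (λ ()) (proj₁ (proj₂ joins′))
      from (inj₂ (refl , e)) with refl ← Fin.toℕ-injective {i = i} {suc zero} (Nat.suc-injective e) =
        via refl κy (λ ()) (proj₁ (proj₂ (proj₂ (proj₂ (proj₂ joins′)))))
      to : Alternating (trace _≟_ (inj₂ i) (inj₁ a) w″) → (a ≡ x × toℕ i ≡ 0) ⊎ (a ≡ y × suc (toℕ i) ≡ 2)
      to t with a G.≟ᵥ x | a G.≟ᵥ y
      ... | no n     | no m     = ⊥-elim (new-other {A} {B} {C} b i n m t)
      ... | yes refl | _        = inj₁ (refl , at-x i t)
      ... | no _     | yes refl = inj₂ (refl , at-y i t)
    uv : Alternating (trace _≟_ u v w″)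
    uv = via refl refl (λ ()) (proj₂ (proj₂ (proj₂ (proj₂ (proj₂ joins′)))))
    news : ∀ {i j} → i ≢ j → Alternating (trace _≟_ (inj₂ i) (inj₂ j) w″) ⇔ Graph._~_ (path 2) i j
    news {zero}     {zero}     n = contradiction refl n
    news {zero}     {suc zero} n = mk⇔ (λ _ → inj₁ refl) (λ _ → uv)
    news {suc zero} {zero}     n = mk⇔ (λ _ → inj₂ refl) (λ _ → Alternating-swap _≟_ (λ ()) w″ uv)
    news {suc zero} {suc zero} n = contradiction refl n

-- Longer paths and pendant paths.

Nontrivial : Graph → Set
Nontrivial G = ∃[ x ] ∃[ y ] (_≢_ {A = V G} x y)

module _ (G : Graph) where
  private
    module G = Graph G

  another : Nontrivial G → ∀ v → ∃[ y ] v ≢ y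
  another (a , b , a≢b) v with v G.≟ᵥ a
  ... | yes refl = b , a≢b
  ... | no n     = a , n

  -- The vertex next to y on a path joining v and y is not needed.
  attach↪join : ∀ v y ℓ → Embedding (attachPath G v ℓ) (joinByPath G v y (2 + ℓ))
  attach↪join v y ℓ = record
    { to        = to
    ; from      = from
    ; from-to   = from-to
    ; to-from   = λ {x} {z} → to-from x z
    ; preserves = λ {x} {z} → preserves x z
    ; reflects  = λ {x} {z} → reflects x z
    }
    where
    module S = Graph (attachPath G v ℓ)
    module T = Graph (joinByPath G v y (2 + ℓ))
    to : S.V → T.V
    to (inj₁ u) = inj₁ u
    to (inj₂ i) = inj₂ (Fin.inject₁ i)
    from : T.V → Maybe S.V
    from (inj₁ u) = just (inj₁ u)
    -- The joining path has 1 + ℓ internal vertices; the one of index ℓ, next to y, is erased.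
    from (inj₂ j) with ℓ Nat.≟ toℕ j
    ... | yes _ = nothing
    ... | no n  = just (inj₂ (Fin.lower₁ j n))
    not-last : ∀ (i : Fin ℓ) → ℓ ≢ toℕ (Fin.inject₁ i)
    not-last i e = Nat.<⇒≢ (subst (Nat._< ℓ) (sym (Fin.toℕ-inject₁ i)) (Fin.toℕ<n i)) (sym e)
    from-to : ∀ x → from (to x) ≡ just x
    from-to (inj₁ u) = refl
    from-to (inj₂ i) with ℓ Nat.≟ toℕ (Fin.inject₁ i)
    ... | yes e = contradiction e (not-last i)
    ... | no n  = cong (just ∘ inj₂) (Fin.lower₁-inject₁′ i n)
    to-from : ∀ x z → from z ≡ just x → z ≡ to x
    to-from x (inj₁ u) refl = refl
    to-from x (inj₂ j) e with ℓ Nat.≟ toℕ j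
    to-from x (inj₂ j) refl | no n = cong inj₂ (sym (Fin.inject₁-lower₁ j n))
    preserves : ∀ x z → x S.~ z → to x T.~ to z
    preserves (inj₁ u) (inj₁ w) e = e
    preserves (inj₁ u) (inj₂ i) (p , q) = inj₁ (p , trans (Fin.toℕ-inject₁ i) q)
    preserves (inj₂ i) (inj₁ u) (p , q) = inj₁ (p , trans (Fin.toℕ-inject₁ i) q)
    preserves (inj₂ i) (inj₂ j) e rewrite Fin.toℕ-inject₁ i | Fin.toℕ-inject₁ j = e
    reflects : ∀ x z → to x T.~ to z → x S.~ z
    reflects (inj₁ u) (inj₁ w) e = e
    reflects (inj₁ u) (inj₂ i) (inj₁ (p , q)) = p , trans (sym (Fin.toℕ-inject₁ i)) q
    reflects (inj₁ u) (inj₂ i) (inj₂ (p , q)) = contradiction (sym (Nat.suc-injective q)) (not-last i)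
    reflects (inj₂ i) (inj₁ u) (inj₁ (p , q)) = p , trans (sym (Fin.toℕ-inject₁ i)) q
    reflects (inj₂ i) (inj₁ u) (inj₂ (p , q)) = contradiction (sym (Nat.suc-injective q)) (not-last i)
    reflects (inj₂ i) (inj₂ j) e rewrite Fin.toℕ-inject₁ i | Fin.toℕ-inject₁ j = e

  -- A path from x is a pendant edge at x followed by a shorter path.
  join↪attach-join : ∀ x y ℓ → Embedding (joinByPath G x y (4 + ℓ))
    (joinByPath (attachPath G x 1) (inj₂ zero) (inj₁ y) (3 + ℓ))
  join↪attach-join x y ℓ = record
    { to        = to
    ; from      = from
    ; from-to   = from-to
    ; to-from   = λ {a} {b} → to-from a b
    ; preserves = λ {a} {b} → preserves a b
    ; reflects  = λ {a} {b} → reflects a b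
    }
    where
    module S = Graph (joinByPath G x y (4 + ℓ))
    module T = Graph (joinByPath (attachPath G x 1) (inj₂ zero) (inj₁ y) (3 + ℓ))
    to : S.V → T.V
    to (inj₁ u)       = inj₁ (inj₁ u)
    to (inj₂ zero)    = inj₁ (inj₂ zero)
    to (inj₂ (suc i)) = inj₂ i
    from : T.V → Maybe S.V
    from (inj₁ (inj₁ u))    = just (inj₁ u)
    from (inj₁ (inj₂ zero)) = just (inj₂ zero)
    from (inj₂ i)           = just (inj₂ (suc i))
    from-to : ∀ a → from (to a) ≡ just a
    from-to (inj₁ u)       = refl
    from-to (inj₂ zero)    = refl
    from-to (inj₂ (suc i)) = refl
    to-from : ∀ a b → from b ≡ just a → b ≡ to a
    to-from a (inj₁ (inj₁ u))    refl = refl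
    to-from a (inj₁ (inj₂ zero)) refl = refl
    to-from a (inj₂ i)           refl = refl
    preserves : ∀ a b → a S.~ b → to a T.~ to b
    preserves (inj₁ u) (inj₁ w) e = e
    preserves (inj₁ u) (inj₂ zero) (inj₁ (refl , _)) = refl , refl
    preserves (inj₁ u) (inj₂ (suc i)) (inj₂ (refl , e)) = inj₂ (refl , Nat.suc-injective e)
    preserves (inj₂ zero) (inj₁ u) (inj₁ (refl , _)) = refl , refl
    preserves (inj₂ (suc i)) (inj₁ u) (inj₂ (refl , e)) = inj₂ (refl , Nat.suc-injective e)
    preserves (inj₂ zero) (inj₂ (suc j)) (inj₁ e) = inj₁ (refl , sym (Nat.suc-injective e))
    preserves (inj₂ (suc i)) (inj₂ zero) (inj₂ e) = inj₁ (refl , sym (Nat.suc-injective e))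
    preserves (inj₂ (suc i)) (inj₂ (suc j)) (inj₁ e) = inj₁ (Nat.suc-injective e)
    preserves (inj₂ (suc i)) (inj₂ (suc j)) (inj₂ e) = inj₂ (Nat.suc-injective e)
    reflects : ∀ a b → to a T.~ to b → a S.~ b
    reflects (inj₁ u) (inj₁ w) e = e
    reflects (inj₁ u) (inj₂ zero) (refl , _) = inj₁ (refl , refl)
    reflects (inj₁ u) (inj₂ (suc i)) (inj₂ (refl , e)) = inj₂ (refl , cong suc e)
    reflects (inj₂ zero) (inj₁ u) (refl , _) = inj₁ (refl , refl)
    reflects (inj₂ (suc i)) (inj₁ u) (inj₂ (refl , e)) = inj₂ (refl , cong suc e)
    reflects (inj₂ zero) (inj₂ zero) e = e
    reflects (inj₂ zero) (inj₂ (suc j)) (inj₁ (_ , e)) = inj₁ (cong suc (sym e))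
    reflects (inj₂ (suc i)) (inj₂ zero) (inj₁ (_ , e)) = inj₂ (cong suc (sym e))
    reflects (inj₂ (suc i)) (inj₂ (suc j)) (inj₁ e) = inj₁ (cong suc e)
    reflects (inj₂ (suc i)) (inj₂ (suc j)) (inj₂ e) = inj₂ (cong suc e)

-- Induction on the length. A pendant edge at x is obtained from a path of length 3 between x and y
-- by erasing a vertex; its new end is then joined to y by a path shorter by one.
joinByPath-presentable : ∀ G {x y} → x ≢ y → ∀ ℓ → Presentable 3 G → Presentable 3 (joinByPath G x y (3 + ℓ))
joinByPath-presentable G x≢y zero    P = Join.join-presentable G x≢y P
joinByPath-presentable G {x} {y} x≢y (suc ℓ) P = Presentable-embedding (join↪attach-join G x y ℓ)
  (joinByPath-presentable (attachPath G x 1) (λ ()) ℓ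
    (Presentable-embedding (attach↪join G x y 1) (Join.join-presentable G x≢y P)))

attachPath-presentable : ∀ G v ℓ → Nontrivial G → Presentable 3 G → Presentable 3 (attachPath G v (suc ℓ))
attachPath-presentable G v ℓ nontrivial P with y , v≢y ← another G nontrivial v =
  Presentable-embedding (attach↪join G v y (suc ℓ)) (joinByPath-presentable G v≢y ℓ P)

-- Words for the Petersen graph and for small prisms.

-- The vertices of a prism and of the Petersen graph: o k on the outer cycle,
-- i k on the inner one.
pattern o k = inj₁ k
pattern i k = inj₂ k

_≟ᵢ_ : DecidableEquality (ℕ ⊎ ℕ)
_≟ᵢ_ = ≡-dec Nat._≟_ Nat._≟_

_≟ᶠ_ : ∀ {m n} → DecidableEquality (Fin m ⊎ Fin n)
_≟ᶠ_ = ≡-dec Fin._≟_ Fin._≟_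

all⊎? : ∀ {m n} {P : Fin m ⊎ Fin n → Set} → (∀ x → Dec (P x)) → Dec (∀ x → P x)
all⊎? P? = map′ (λ (f , g) → Sum.[ f , g ]) (λ h → h ∘ inj₁ , h ∘ inj₂)
  (Fin.all? (P? ∘ inj₁) ×-dec Fin.all? (P? ∘ inj₂))

module _ {m n} {_~_ : Fin m ⊎ Fin n → Fin m ⊎ Fin n → Set} (_~?_ : Decidable _~_) where

  presents? : ∀ k w → Dec ((∀ x → (# mono _≟ᶠ_ x) w ≡ k) ×
    (∀ x y → x ≢ y → (x ~ y → Alternating (trace _≟ᶠ_ x y w)) × (Alternating (trace _≟ᶠ_ x y w) → x ~ y)))
  presents? k w = all⊎? (λ x → (# mono _≟ᶠ_ x) w Nat.≟ k) ×-dec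
    all⊎? λ x → all⊎? λ y → ¬? (x ≟ᶠ y) →-dec
      (((x ~? y) →-dec T? _) ×-dec (T? _ →-dec (x ~? y)))

  verified : ∀ k w → True (presents? k w) → Presents _≟ᶠ_ _~_ k w
  verified k w t with c , f ← toWitness t = record
    { count = c ; sound = λ n → proj₁ (f _ _ n) ; complete = λ n → proj₂ (f _ _ n) }

module _ (n : ℕ) .{{_ : Nat.NonZero n}} where

  -- The letters of a word are written with natural numbers and reduced modulo n only here; the
  -- shift s is a rotation of the prism.
  ρ : ℕ → ℕ ⊎ ℕ → Fin n ⊎ Fin n
  ρ s = Sum.map (λ k → (k + s) mod n) (λ k → (k + s) mod n)

-- For n ≥ 5 the word block 0 ⋯ block (n ∸ 1), with the indices read modulo n,
-- represents the prism (it was found by a search over periodic words).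
block : ℕ → List (ℕ ⊎ ℕ)
block k = o (3 + k) ∷ o (2 + k) ∷ o (1 + k) ∷ i k ∷ i (3 + k) ∷ i (2 + k) ∷ []

blocks : ℕ → ℕ → List (ℕ ⊎ ℕ)
blocks k zero    = []
blocks k (suc m) = block k ++ blocks (suc k) m

word₃ : List (ℕ ⊎ ℕ)
word₃ =
  i 0 ∷ i 1 ∷ o 2 ∷ o 0 ∷ i 2 ∷ i 0 ∷ o 1 ∷ o 2 ∷ i 1 ∷ i 2 ∷
  o 0 ∷ o 1 ∷ o 2 ∷ i 0 ∷ o 0 ∷ i 1 ∷ o 1 ∷ i 2 ∷ []

word₄ : List (ℕ ⊎ ℕ)
word₄ =
  o 2 ∷ o 3 ∷ i 1 ∷ i 2 ∷ i 0 ∷ o 1 ∷ i 1 ∷ o 2 ∷ i 3 ∷ i 2 ∷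
  o 0 ∷ o 3 ∷ o 1 ∷ o 2 ∷ i 0 ∷ o 0 ∷ i 1 ∷ o 1 ∷ i 3 ∷ i 0 ∷
  o 3 ∷ o 0 ∷ i 2 ∷ i 3 ∷ []

petersenWord : List (ℕ ⊎ ℕ)
petersenWord =
  o 0 ∷ i 2 ∷ i 4 ∷ i 3 ∷ i 0 ∷ o 3 ∷ o 4 ∷ i 1 ∷ i 3 ∷ o 2 ∷
  o 3 ∷ i 2 ∷ o 1 ∷ o 2 ∷ o 0 ∷ i 0 ∷ i 4 ∷ i 2 ∷ i 1 ∷ i 3 ∷
  o 4 ∷ i 4 ∷ o 1 ∷ i 1 ∷ o 0 ∷ o 3 ∷ o 2 ∷ o 1 ∷ o 4 ∷ i 0 ∷ []

petersen-presentable : Presentable 3 petersen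
petersen-presentable = map (ρ 5 0) petersenWord ,
  Presents-≟ (verified (Graph._~?_ petersen) 3 (map (ρ 5 0) petersenWord) tt)

prism₃-presentable : ∀ 3≤n → Presentable 3 (prism 3 3≤n)
prism₃-presentable p = _ , Presents-≟ (verified (Graph._~?_ (prism 3 p)) 3 (map (ρ 3 0) word₃) tt)

prism₄-presentable : ∀ 3≤n → Presentable 3 (prism 4 3≤n)
prism₄-presentable p = _ , Presents-≟ (verified (Graph._~?_ (prism 4 p)) 3 (map (ρ 4 0) word₄) tt)

-- For n = 5, 6, 7 the indices in the first five blocks, which run up to 7, collide modulo n. These
-- cases of the periodic word are evaluated directly; `LargePrism` starts at n = 8.
prism₅-presentable : ∀ 3≤n → Presentable 3 (prism 5 3≤n)
prism₅-presentable p = _ , Presents-≟ (verified (Graph._~?_ (prism 5 p)) 3 (map (ρ 5 0) (blocks 0 5)) tt)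

prism₆-presentable : ∀ 3≤n → Presentable 3 (prism 6 3≤n)
prism₆-presentable p = _ , Presents-≟ (verified (Graph._~?_ (prism 6 p)) 3 (map (ρ 6 0) (blocks 0 6)) tt)

prism₇-presentable : ∀ 3≤n → Presentable 3 (prism 7 3≤n)
prism₇-presentable p = _ , Presents-≟ (verified (Graph._~?_ (prism 7 p)) 3 (map (ρ 7 0) (blocks 0 7)) tt)

-- Residues modulo n and the edges of a cycle.

module Cyclic (m : ℕ) where

  n : ℕ
  n = suc m

  e : ℕ → Fin n
  e k = k mod n

  toℕ-e : ∀ k → toℕ (e k) ≡ k % n
  toℕ-e k = Fin.toℕ-fromℕ< (m%n<n k n)

  e-cong-% : ∀ k l → k % n ≡ l % n → e k ≡ e l
  e-cong-% k l p = Fin.toℕ-injective (trans (toℕ-e k) (trans p (sym (toℕ-e l))))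

  e-toℕ : ∀ x → e (toℕ x) ≡ x
  e-toℕ x = Fin.toℕ-injective (trans (toℕ-e (toℕ x)) (m<n⇒m%n≡m (Fin.toℕ<n x)))

  e-periodic : ∀ k → e (k + n) ≡ e k
  e-periodic k = e-cong-% (k + n) k ([m+n]%n≡m%n k n)

  e-suc : ∀ k → e (suc (toℕ (e k))) ≡ e (suc k)
  e-suc k = e-cong-% (suc (toℕ (e k))) (suc k) (begin
    suc (toℕ (e k)) % n         ≡⟨ cong (λ a → suc a % n) (toℕ-e k) ⟩
    suc (k % n) % n             ≡⟨ %-distribˡ-+ 1 (k % n) n ⟩
    (1 % n + k % n % n) % n     ≡⟨ cong (λ a → (1 % n + a) % n) (m%n%n≡m%n k n) ⟩
    (1 % n + k % n) % n         ≡⟨ %-distribˡ-+ 1 k n ⟨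
    suc k % n                   ∎)
    where open ≡-Reasoning

  -- Suppose the remainders agree. Then k < l makes the quotient of k the smaller one, while l < k +
  -- n keeps the quotient of l from exceeding it.
  e-≢ : ∀ {k l} → k < l → l < k + n → e k ≢ e l
  e-≢ {k} {l} k<l l<k+n p = Nat.<⇒≱ a<b (Nat.≤-pred b<1+a)
    where
    r≡ : k % n ≡ l % n
    r≡ = trans (sym (toℕ-e k)) (trans (cong toℕ p) (toℕ-e l))
    a = k / n
    b = l / n
    k≡ : k ≡ k % n + a * n
    k≡ = m≡m%n+[m/n]*n k n
    l≡ : l ≡ k % n + b * n
    l≡ = trans (m≡m%n+[m/n]*n l n) (cong (_+ b * n) (sym r≡))
    a<b : a < b
    a<b = Nat.*-cancelʳ-< n a b (Nat.+-cancelˡ-< (k % n) (a * n) (b * n) (subst₂ _<_ k≡ l≡ k<l))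
    b<1+a : b < suc a
    b<1+a = Nat.*-cancelʳ-< n b (suc a) (Nat.+-cancelˡ-< (k % n) (b * n) (suc a * n)
      (subst₂ _<_ l≡ (trans (cong (_+ n) k≡) (trans (Nat.+-assoc (k % n) (a * n) n)
        (cong (k % n +_) (Nat.+-comm (a * n) n)))) l<k+n))

  -- Names a vertex by its offset from s, so that questions about residues become case distinctions
  -- on a number below n.
  e-shift : ∀ s y → ∃[ b ] (b < n × y ≡ e (b + s))
  e-shift zero    y = toℕ y , Fin.toℕ<n y , sym (trans (cong e (Nat.+-identityʳ (toℕ y))) (e-toℕ y))
  e-shift (suc s) y with e-shift s y
  -- Offset 0 from s is offset m from s + 1, because m + (s + 1) = s + n.
  ... | zero  , _   , refl = m , Nat.n<1+n m , sym (trans (cong e (trans (Nat.+-suc m s) (Nat.+-comm n s))) (e-periodic s))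
  ... | suc b , b<n , refl = b , Nat.<-trans (Nat.n<1+n b) b<n , cong e (sym (Nat.+-suc b s))

  next : Fin n → Fin n → Set
  next x y = suc (toℕ x) ≡ toℕ y ⊎ (suc (toℕ x) ≡ n × toℕ y ≡ 0)

  next⇒≡ : ∀ {x y} → next x y → y ≡ e (suc (toℕ x))
  next⇒≡ {x} {y} (inj₁ p) = trans (sym (e-toℕ y)) (cong e (sym p))
  next⇒≡ {x} {y} (inj₂ (p , q)) = trans (sym (e-toℕ y)) (trans (cong e q) (trans (sym (e-periodic 0)) (cong e (sym p))))

  next-e : ∀ k → next (e k) (e (suc k))
  next-e k with Nat.<-cmp (suc (toℕ (e k))) n
  ... | tri< l _ _ = inj₁ (sym (trans (cong toℕ (sym (e-suc k))) (trans (toℕ-e (suc (toℕ (e k)))) (m<n⇒m%n≡m l))))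
  ... | tri≈ _ p _ = inj₂ (p , trans (cong toℕ (sym (e-suc k))) (trans (toℕ-e (suc (toℕ (e k)))) (trans (cong (_% n) p) (n%n≡0 n))))
  ... | tri> _ _ l = contradiction (Fin.toℕ<n (e k)) (Nat.<⇒≱ l)

-- The periodic word for the prisms with n = 8 + c.

module LargePrism (c : ℕ) where
  open Cyclic (7 + c)

  private
    idx : ℕ ⊎ ℕ → ℕ
    idx = Sum.[ id , id ]

  -- The shift that takes index 3 to x, since 3 + `anchor x` = n + `toℕ x`. Letters of index 3 and 4
  -- are the convenient ones: modulo n, they occur in the first five blocks only.
  anchor : Fin n → ℕ
  anchor x = 5 + c + toℕ x

  e-anchor : ∀ x → e (3 + anchor x) ≡ x
  e-anchor x = trans (cong e (Nat.+-comm n (toℕ x))) (trans (e-periodic (toℕ x)) (e-toℕ x))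

  private
    word : ℕ → List (Fin n ⊎ Fin n)
    word s = map (ρ n s) (blocks 0 n)

  map-ρ-suc : ∀ s k m → map (ρ n (suc s)) (blocks k m) ≡ map (ρ n s) (blocks (suc k) m)
  map-ρ-suc s k zero    = refl
  map-ρ-suc s k (suc m) rewrite Nat.+-suc k s = cong (λ w → _ ∷ _ ∷ _ ∷ _ ∷ _ ∷ _ ∷ w) (map-ρ-suc s (suc k) m)

  blocks-snoc : ∀ k m → blocks k (suc m) ≡ blocks k m ++ block (m + k)
  blocks-snoc k zero    = refl
  blocks-snoc k (suc m) = cong (block k ++_) (trans (blocks-snoc (suc k) m)
    (cong (λ l → blocks (suc k) m ++ block l) (Nat.+-suc m k)))

  block-periodic : ∀ s → map (ρ n s) (block n) ≡ map (ρ n s) (block 0)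
  block-periodic s = cong₂ _∷_ (outer 3) (cong₂ _∷_ (outer 2) (cong₂ _∷_ (outer 1)
    (cong₂ _∷_ (inner 0) (cong₂ _∷_ (inner 3) (cong₂ _∷_ (inner 2) refl)))))
    where
    shift : ∀ k → e (k + n + s) ≡ e (k + s)
    shift k = trans (cong e (trans (Nat.+-assoc k n s)
      (trans (cong (k +_) (Nat.+-comm n s)) (sym (Nat.+-assoc k s n))))) (e-periodic (k + s))
    outer : ∀ k → ρ n s (o (k + n)) ≡ ρ n s (o k)
    outer k = cong o_ (shift k)
      where o_ = inj₁
    inner : ∀ k → ρ n s (i (k + n)) ≡ ρ n s (i k)
    inner k = cong i_ (shift k)
      where i_ = inj₂

  private
    head rest : ℕ → List (Fin n ⊎ Fin n)
    head s = map (ρ n s) (block 0)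
    rest s = map (ρ n s) (blocks 1 (7 + c))

  -- Modulo n, `block n` is `block 0`. Shifting all indices by one therefore amounts to moving the
  -- first block to the end, which changes no count and no alternation.
  word-suc : ∀ s → word (suc s) ≡ rest s ++ head s
  word-suc s = begin
    word (suc s)                                              ≡⟨ map-ρ-suc s 0 n ⟩
    map (ρ n s) (blocks 1 n)                                  ≡⟨ cong (map (ρ n s)) (blocks-snoc 1 (7 + c)) ⟩
    map (ρ n s) (blocks 1 (7 + c) ++ block (7 + c + 1))       ≡⟨ map-++ (ρ n s) (blocks 1 (7 + c)) _ ⟩
    rest s ++ map (ρ n s) (block (7 + c + 1))                 ≡⟨ cong (λ k → rest s ++ map (ρ n s) (block k)) (Nat.+-comm (7 + c) 1) ⟩
    rest s ++ map (ρ n s) (block n)                           ≡⟨ cong (rest s ++_) (block-periodic s) ⟩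
    rest s ++ head s                                          ∎
    where open ≡-Reasoning

  count-word : ∀ s x → (# mono _≟ᶠ_ x) (word s) ≡ (# mono _≟ᶠ_ x) (word 0)
  count-word zero    x = refl
  count-word (suc s) x = trans (cong (# mono _≟ᶠ_ x) (word-suc s))
    (trans (#-swap (mono _≟ᶠ_ x) (rest s) (head s)) (count-word s x))

  ρ-≢ : ∀ s a z → idx a < idx z → idx z < idx a + n → ρ n s z ≢ ρ n s a
  ρ-≢ s (o a) (o z) p q r = e-≢ (Nat.+-monoˡ-< s p) (subst (z + s <_)
    (trans (Nat.+-assoc a n s) (trans (cong (a +_) (Nat.+-comm n s)) (sym (Nat.+-assoc a s n)))) (Nat.+-monoˡ-< s q))
    (sym (inj₁-injective r))
  ρ-≢ s (i a) (i z) p q r = e-≢ (Nat.+-monoˡ-< s p) (subst (z + s <_)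
    (trans (Nat.+-assoc a n s) (trans (cong (a +_) (Nat.+-comm n s)) (sym (Nat.+-assoc a s n)))) (Nat.+-monoˡ-< s q))
    (sym (inj₂-injective r))

  ρ-injective : ∀ s a z → idx a < n → idx z < n → ρ n s z ≡ ρ n s a → z ≡ a
  ρ-injective s a z p q r with Nat.<-cmp (idx a) (idx z)
  ... | tri< l _ _ = contradiction r (ρ-≢ s a z l (Nat.<-≤-trans q (Nat.m≤n+m n (idx a))))
  ... | tri> _ _ l = contradiction (sym r) (ρ-≢ s z a l (Nat.<-≤-trans p (Nat.m≤n+m n (idx z))))
  ρ-injective s (o a) (o .a) p q r | tri≈ _ refl _ = refl
  ρ-injective s (i a) (i .a) p q r | tri≈ _ refl _ = refl

  side-ρ : ∀ s a b → a ≢ b → idx a < n → idx b < n → ∀ z → idx z < n →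
    side _≟ᶠ_ (ρ n s a) (ρ n s b) (ρ n s z) ≡ side _≟ᵢ_ a b z
  side-ρ s a b a≢b p q z r with z ≟ᵢ a
  ... | yes refl = side-left _≟ᶠ_ (ρ n s a) (ρ n s b)
  ... | no f with z ≟ᵢ b
  ...   | yes refl = side-right _≟ᶠ_ (a≢b ∘ ρ-injective s b a q p)
  ...   | no g     = side-other _≟ᶠ_ (f ∘ ρ-injective s a z p r) (g ∘ ρ-injective s b z q r)

  mono-ρ : ∀ s a → idx a < n → ∀ z → idx z < n →
    mono _≟ᶠ_ (ρ n s a) (ρ n s z) ≡ mono _≟ᵢ_ a z
  mono-ρ s a p z r with z ≟ᵢ a
  ... | yes refl = mono-refl _≟ᶠ_ (ρ n s a)
  ... | no f     = mono-≢ _≟ᶠ_ (f ∘ ρ-injective s a z p r)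

  mapMaybe-All : ∀ {A B C : Set} {P : A → Set} (f : A → B) {g : B → Maybe C} {h : A → Maybe C} →
    (∀ {z} → P z → g (f z) ≡ h z) → ∀ {w} → All P w → mapMaybe g (map f w) ≡ mapMaybe h w
  mapMaybe-All f p [] = refl
  mapMaybe-All f {h = h} p {z ∷ w} (q ∷ qs) rewrite p q with h z
  ... | just x  = cong (x ∷_) (mapMaybe-All f p qs)
  ... | nothing = mapMaybe-All f p qs

  -- Five blocks, because the last occurrence of an index 3 or 4 before the indices wrap around is
  -- the `i 4` in `block 4`.
  prefix : List (ℕ ⊎ ℕ)
  prefix = blocks 0 5

  suffix : List (ℕ ⊎ ℕ)
  suffix = blocks 5 (3 + c)

  prefix-All : All (λ z → idx z < n) prefix
  prefix-All = All.map {P = λ z → idx z < 8} (λ p → Nat.≤-trans p (Nat.m≤m+n 8 c))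
    (toWitness {a? = All.all? (λ z → idx z Nat.<? 8) prefix} tt)

  blocks-All : ∀ k m → All (λ z → k ≤ idx z × idx z < m + k + 3) (blocks k m)
  blocks-All k zero    = []
  blocks-All k (suc m) = at 3 (s≤s (s≤s (s≤s (s≤s z≤n)))) ∷ at 2 (s≤s (s≤s (s≤s z≤n)))
    ∷ at 1 (s≤s (s≤s z≤n)) ∷ at 0 (s≤s z≤n)
    ∷ at 3 (s≤s (s≤s (s≤s (s≤s z≤n)))) ∷ at 2 (s≤s (s≤s (s≤s z≤n)))
    ∷ All.map (λ { {z} (p , q) → Nat.≤-trans (Nat.n≤1+n k) p , subst (λ b → idx z < b + 3) (Nat.+-suc m k) q })
        (blocks-All (suc k) m)
    where
    at : ∀ j → j < 4 → k ≤ j + k × j + k < suc m + k + 3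
    at j l = Nat.m≤n+m k j , Nat.<-≤-trans (Nat.+-monoˡ-< k l)
      (Nat.≤-trans (Nat.≤-reflexive (Nat.+-comm 4 k)) (Nat.≤-trans (Nat.m≤n+m (k + 4) m) (Nat.≤-reflexive
        (trans (cong (m +_) (Nat.+-suc k 3)) (trans (Nat.+-suc m (k + 3)) (cong suc (sym (Nat.+-assoc m k 3))))))))

  suffix-All : All (λ z → 5 ≤ idx z × idx z < 3 + n) suffix
  suffix-All = All.map (λ { (p , q) → p , Nat.≤-trans q (Nat.≤-reflexive
    (trans (Nat.+-comm (3 + c + 5) 3) (cong (λ a → 6 + a) (Nat.+-comm c 5)))) }) (blocks-All 5 (3 + c))

  -- The indices in the suffix lie strictly between that of a and the same plus n, so they never
  -- agree with it modulo n.
  suffix-≢ : ∀ s a z → 3 ≤ idx a → idx a ≤ 4 → 5 ≤ idx z × idx z < 3 + n → ρ n s z ≢ ρ n s a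
  suffix-≢ s a z p q (l , u) = ρ-≢ s a z (Nat.≤-trans (s≤s q) l) (Nat.<-≤-trans u (Nat.+-monoˡ-≤ n p))

  mapMaybe-none : ∀ {A B C : Set} {P : A → Set} (f : A → B) {g : B → Maybe C} →
    (∀ {z} → P z → g (f z) ≡ nothing) → ∀ {w} → All P w → mapMaybe g (map f w) ≡ []
  mapMaybe-none f p []       = refl
  mapMaybe-none f p (q ∷ qs) rewrite p q = mapMaybe-none f p qs

  mapMaybe-word : ∀ {B : Set} (h : Fin n ⊎ Fin n → Maybe B) s →
    mapMaybe h (word s) ≡ mapMaybe h (map (ρ n s) prefix) ++ mapMaybe h (map (ρ n s) suffix)
  mapMaybe-word h s = trans (cong (mapMaybe h) (map-++ (ρ n s) prefix suffix))
    (mapMaybe-++ h (map (ρ n s) prefix) (map (ρ n s) suffix))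

  private
    3<n : 3 < n
    3<n = Nat.m≤m+n 4 (4 + c)

    4<n : 4 < n
    4<n = Nat.m≤m+n 5 (3 + c)

  -- An initial segment of an alternating trace alternates. This one-sided test suffices to refute
  -- non-edges, for which b may have any index.
  pattern-prefix : ∀ s {a b} → a ≢ b → idx a < n → idx b < n →
    Alternating (trace _≟ᶠ_ (ρ n s a) (ρ n s b) (word s)) → Alternating (trace _≟ᵢ_ a b prefix)
  pattern-prefix s {a} {b} a≢b p q t = subst Alternating
    (mapMaybe-All (ρ n s) {g = h} {side _≟ᵢ_ a b} (λ {z} → side-ρ s a b a≢b p q z) prefix-All)
    (Alternating-++ˡ (mapMaybe h (map (ρ n s) prefix)) (mapMaybe h (map (ρ n s) suffix))
      (subst Alternating (mapMaybe-word h s) t))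
    where h = side _≟ᶠ_ (ρ n s a) (ρ n s b)

  -- For edges the whole trace is required; between letters of index 3 or 4 it is contained in the
  -- prefix.
  pattern-word : ∀ s {a b} → a ≢ b → 3 ≤ idx a → idx a ≤ 4 → 3 ≤ idx b → idx b ≤ 4 →
    trace _≟ᶠ_ (ρ n s a) (ρ n s b) (word s) ≡ trace _≟ᵢ_ a b prefix
  pattern-word s {a} {b} f p q p′ q′ = trans (mapMaybe-word h s) (trans (cong₂ _++_
    (mapMaybe-All (ρ n s) {g = h} {side _≟ᵢ_ a b}
      (λ {z} → side-ρ s a b f (Nat.≤-<-trans q 4<n) (Nat.≤-<-trans q′ 4<n) z) prefix-All)
    (mapMaybe-none (ρ n s) {g = h} (λ {z} r → side-other _≟ᶠ_ (suffix-≢ s a z p q r) (suffix-≢ s b z p′ q′ r)) suffix-All))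
    (++-identityʳ _))
    where h = side _≟ᶠ_ (ρ n s a) (ρ n s b)

  count-3 : ∀ s {a} → idx a ≡ 3 → (# mono _≟ᶠ_ (ρ n s a)) (word s) ≡ (# mono _≟ᵢ_ a) prefix
  count-3 s {a} a≡3 = cong length (trans (mapMaybe-word h s) (trans (cong₂ _++_
    (mapMaybe-All (ρ n s) {g = h} {mono _≟ᵢ_ a} (λ {z} → mono-ρ s a (subst (_< n) (sym a≡3) 3<n) z) prefix-All)
    (mapMaybe-none (ρ n s) {g = h} (λ {z} r → mono-≢ _≟ᶠ_ (suffix-≢ s a z (Nat.≤-reflexive (sym a≡3))
      (subst (_≤ 4) (sym a≡3) (Nat.n≤1+n 3)) r)) suffix-All))
    (++-identityʳ _)))
    where h = mono _≟ᶠ_ (ρ n s a)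

  count : ∀ x → (# mono _≟ᶠ_ x) (word 0) ≡ 3
  count (o x) = trans (sym (count-word (anchor x) (o x)))
    (subst (λ v → (# mono _≟ᶠ_ v) (word (anchor x)) ≡ 3) (cong inj₁ (e-anchor x)) (count-3 (anchor x) {o 3} refl))
  count (i x) = trans (sym (count-word (anchor x) (i x)))
    (subst (λ v → (# mono _≟ᶠ_ v) (word (anchor x)) ≡ 3) (cong inj₂ (e-anchor x)) (count-3 (anchor x) {i 3} refl))

  private
    Alt : ℕ → Fin n ⊎ Fin n → Fin n ⊎ Fin n → Set
    Alt s x y = Alternating (trace _≟ᶠ_ x y (word s))

  same-count : ∀ s x y → (# mono _≟ᶠ_ x) (word s) ≡ (# mono _≟ᶠ_ y) (word s)
  same-count s x y = trans (count-word s x) (trans (count x) (sym (trans (count-word s y) (count y))))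

  Alt-suc : ∀ s {x y} → x ≢ y → Alt s x y ⇔ Alt (suc s) x y
  Alt-suc s {x} {y} f = mk⇔
    (λ t → subst (Alternating ∘ trace _≟ᶠ_ x y) (sym (word-suc s))
      (Alternating-pattern-rotate _≟ᶠ_ (head s) (rest s) f (same-count s x y) t))
    (λ t → Alternating-pattern-rotate _≟ᶠ_ (rest s) (head s) f
      (subst (λ w → (# mono _≟ᶠ_ x) w ≡ (# mono _≟ᶠ_ y) w) (word-suc s) (same-count (suc s) x y))
      (subst (Alternating ∘ trace _≟ᶠ_ x y) (word-suc s) t))

  Alt-shift : ∀ s {x y} → x ≢ y → Alt 0 x y ⇔ Alt s x y
  Alt-shift zero    f = mk⇔ id id
  Alt-shift (suc s) {x} {y} f = mk⇔
    (Equivalence.to (Alt-suc s {x} {y} f) ∘ Equivalence.to (Alt-shift s {x} {y} f))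
    (Equivalence.from (Alt-shift s {x} {y} f) ∘ Equivalence.from (Alt-suc s {x} {y} f))

  module _ (3≤n : 3 ≤ n) where
    open Graph (prism n 3≤n) using (_~_)

    -- On the prefix `o 3` alternates, among the other outer letters, only with those of index 2 and
    -- 4; all other cases are refuted by evaluation.
    complete-outer : ∀ s b → b ≢ 3 → b < n → Alternating (trace _≟ᵢ_ (o 3) (o b) prefix) →
      next (e (3 + s)) (e (b + s)) ⊎ next (e (b + s)) (e (3 + s))
    complete-outer s 2 n l t = inj₂ (next-e (2 + s))
    complete-outer s 3 n l t = contradiction refl n
    complete-outer s 4 n l t = inj₁ (next-e (3 + s))
    complete-outer s 0 n l ()
    complete-outer s 1 n l ()
    complete-outer s 5 n l ()
    complete-outer s 6 n l ()
    complete-outer s 7 n l ()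
    -- Indices from 8 on do not occur in the prefix, and the trace is `o 3` three times.
    complete-outer s (suc (suc (suc (suc (suc (suc (suc (suc b)))))))) n l ()

    complete-inner : ∀ s b → b ≢ 3 → b < n → Alternating (trace _≟ᵢ_ (i 3) (i b) prefix) →
      next (e (3 + s)) (e (b + s)) ⊎ next (e (b + s)) (e (3 + s))
    complete-inner s 2 n l t = inj₂ (next-e (2 + s))
    complete-inner s 3 n l t = contradiction refl n
    complete-inner s 4 n l t = inj₁ (next-e (3 + s))
    complete-inner s 0 n l ()
    complete-inner s 1 n l ()
    complete-inner s 5 n l ()
    complete-inner s 6 n l ()
    complete-inner s 7 n l ()
    complete-inner s (suc (suc (suc (suc (suc (suc (suc (suc b)))))))) n l ()

    complete-rung : ∀ s b → b < n → Alternating (trace _≟ᵢ_ (o 3) (i b) prefix) →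
      e (3 + s) ≡ e (b + s)
    complete-rung s 3 l t = refl
    complete-rung s 0 l ()
    complete-rung s 1 l ()
    complete-rung s 2 l ()
    complete-rung s 4 l ()
    complete-rung s 5 l ()
    complete-rung s 6 l ()
    complete-rung s 7 l ()
    complete-rung s (suc (suc (suc (suc (suc (suc (suc (suc b)))))))) l ()

    complete-oi : ∀ x y → Alt 0 (o x) (i y) → x ≡ y
    complete-oi x y t with e-shift (anchor x) y
    ... | b , l , refl = trans (sym (e-anchor x)) (complete-rung (anchor x) b l
      (pattern-prefix (anchor x) {o 3} {i b} (λ ()) 3<n l
        (subst (λ z → Alt (anchor x) (o z) (i (e (b + anchor x)))) (sym (e-anchor x))
          (Equivalence.to (Alt-shift (anchor x) {o x} {i (e (b + anchor x))} (λ ())) t))))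

    -- The word is rotated until x has index 3; y then has some index b at the same shift, and the
    -- finite tables above apply.
    complete : ∀ x y → x ≢ y → Alt 0 x y → x ~ y
    complete (o x) (o y) f t with e-shift (anchor x) y
    ... | b , l , refl = subst (λ z → next z y′ ⊎ next y′ z) (e-anchor x)
      (complete-outer (anchor x) b b≢3 l
      (pattern-prefix (anchor x) {o 3} {o b} (b≢3 ∘ sym ∘ inj₁-injective) 3<n l
        (subst (λ z → Alt (anchor x) (o z) (o y′)) (sym (e-anchor x))
          (Equivalence.to (Alt-shift (anchor x) {o x} {o y′} f) t))))
      where
      y′ = e (b + anchor x)
      b≢3 : b ≢ 3
      b≢3 refl = f (cong inj₁ (sym (e-anchor x)))
    complete (i x) (i y) f t with e-shift (anchor x) y
    ... | b , l , refl = subst (λ z → next z y′ ⊎ next y′ z) (e-anchor x)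
      (complete-inner (anchor x) b b≢3 l
      (pattern-prefix (anchor x) {i 3} {i b} (b≢3 ∘ sym ∘ inj₂-injective) 3<n l
        (subst (λ z → Alt (anchor x) (i z) (i y′)) (sym (e-anchor x))
          (Equivalence.to (Alt-shift (anchor x) {i x} {i y′} f) t))))
      where
      y′ = e (b + anchor x)
      b≢3 : b ≢ 3
      b≢3 refl = f (cong inj₂ (sym (e-anchor x)))
    complete (o x) (i y) f t = complete-oi x y t
    complete (i x) (o y) f t = complete-oi y x (Alternating-swap _≟ᶠ_ {i x} {o y} f (word 0) t)

    -- Up to rotation and order of its ends, an edge joins letters of index 3 or 4. Its alternation
    -- is evaluated on the prefix, by `tt` in the three uses below, and carried back to shift 0.
    sound-anchored : ∀ s {a b} → a ≢ b → 3 ≤ idx a → idx a ≤ 4 → 3 ≤ idx b → idx b ≤ 4 →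
      Alternating (trace _≟ᵢ_ a b prefix) → ∀ {x y} → ρ n s a ≡ x → ρ n s b ≡ y → x ≢ y → Alt 0 x y
    sound-anchored s f p q p′ q′ t refl refl g =
      Equivalence.from (Alt-shift s g) (subst Alternating (sym (pattern-word s f p q p′ q′)) t)

    e-next : ∀ {x y} → next x y → e (4 + anchor x) ≡ y
    e-next {x} {y} r = trans (sym (e-suc (3 + anchor x))) (trans (cong (λ z → e (suc (toℕ z))) (e-anchor x)) (sym (next⇒≡ r)))

    sound-o : ∀ x y → next x y → o x ≢ o y → Alt 0 (o x) (o y)
    sound-o x y r = sound-anchored (anchor x) {o 3} {o 4} (λ ()) Nat.≤-refl (Nat.n≤1+n 3) (Nat.n≤1+n 3) Nat.≤-refl tt
      (cong inj₁ (e-anchor x)) (cong inj₁ (e-next r))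

    sound-i : ∀ x y → next x y → i x ≢ i y → Alt 0 (i x) (i y)
    sound-i x y r = sound-anchored (anchor x) {i 3} {i 4} (λ ()) Nat.≤-refl (Nat.n≤1+n 3) (Nat.n≤1+n 3) Nat.≤-refl tt
      (cong inj₂ (e-anchor x)) (cong inj₂ (e-next r))

    sound-oi : ∀ x → Alt 0 (o x) (i x)
    sound-oi x = sound-anchored (anchor x) {o 3} {i 3} (λ ()) Nat.≤-refl (Nat.n≤1+n 3) Nat.≤-refl (Nat.n≤1+n 3) tt
      (cong inj₁ (e-anchor x)) (cong inj₂ (e-anchor x)) (λ ())

    sound : ∀ x y → x ≢ y → x ~ y → Alt 0 x y
    sound (o x) (o y) f (inj₁ r) = sound-o x y r f
    sound (o x) (o y) f (inj₂ r) = Alternating-swap _≟ᶠ_ {o y} {o x} (f ∘ sym) (word 0) (sound-o y x r (f ∘ sym))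
    sound (i x) (i y) f (inj₁ r) = sound-i x y r f
    sound (i x) (i y) f (inj₂ r) = Alternating-swap _≟ᶠ_ {i y} {i x} (f ∘ sym) (word 0) (sound-i y x r (f ∘ sym))
    sound (o x) (i y) f refl = sound-oi x
    sound (i x) (o y) f refl = Alternating-swap _≟ᶠ_ {o x} {i x} (λ ()) (word 0) (sound-oi x)

    presentable : Presentable 3 (prism n 3≤n)
    presentable = word 0 , Presents-≟ {_≟_ = _≟ᶠ_} record
      { count = count ; sound = λ {x} {y} → sound x y ; complete = λ {x} {y} → complete x y }

prism-presentable : ∀ n (3≤n : 3 ≤ n) → Presentable 3 (prism n 3≤n)
prism-presentable 0 ()
prism-presentable 1 (s≤s ())
prism-presentable 2 (s≤s (s≤s ()))
prism-presentable 3 = prism₃-presentable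
prism-presentable 4 = prism₄-presentable
prism-presentable 5 = prism₅-presentable
prism-presentable 6 = prism₆-presentable
prism-presentable 7 = prism₇-presentable
prism-presentable (suc (suc (suc (suc (suc (suc (suc (suc c)))))))) = LargePrism.presentable c

-- Lower bounds for the Petersen graph and the prisms.

module ChordsOf (G : Graph) where
  open Graph G public using (_~_; _~?_; ~-irrefl) renaming (_≟ᵥ_ to _≟_)
  open Chords (Graph._≟ᵥ_ G) {Graph._~_ G} (Graph._~?_ G)
    (λ {x} {y} → Graph.~-sym G {x} {y}) (λ {x} → Graph.~-irrefl G {x}) public

any⊎? : ∀ {m n} {P : Fin m ⊎ Fin n → Set} → (∀ x → Dec (P x)) → Dec (∃ P)
any⊎? P? = map′ (λ { (inj₁ (x , p)) → inj₁ x , p ; (inj₂ (x , p)) → inj₂ x , p })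
  (λ { (inj₁ x , p) → inj₁ (x , p) ; (inj₂ x , p) → inj₂ (x , p) })
  (Fin.any? (P? ∘ inj₁) ⊎-dec Fin.any? (P? ∘ inj₂))

module PetersenChords where
  open ChordsOf petersen

  Reach : V petersen → ℕ → V petersen → V petersen → Set
  Reach u zero    x y = x ≡ y
  Reach u (suc k) x y = x ≡ y ⊎ ∃[ a ] (x ~ a × Far u a × Reach u k a y)

  far? : ∀ u x → Dec (Far u x)
  far? u x = ¬? (x ≟ᶠ u) ×-dec ¬? (x ~? u)

  reach? : ∀ u k x y → Dec (Reach u k x y)
  reach? u zero    x y = x ≟ᶠ y
  reach? u (suc k) x y = (x ≟ᶠ y) ⊎-dec any⊎? λ a → (x ~? a) ×-dec far? u a ×-dec reach? u k a y

  -- The six vertices far from u form a cycle of length 6, so walks of at most 3 steps connect them.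
  reachable : ∀ u x y → Far u x → Far u y → Reach u 3 x y
  reachable = from-yes (all⊎? λ u → all⊎? λ x → all⊎? λ y → far? u x →-dec (far? u y →-dec reach? u 3 x y))

  connected : ∀ u → ConnectedAwayFrom u
  connected u Q step {x} {y} far-x far-y q = go 3 far-x q (reachable u x y far-x far-y)
    where
    go : ∀ k {x} → Far u x → Q x → Reach u k x y → Q y
    go zero    fx q refl = q
    go (suc k) fx q (inj₁ refl) = q
    go (suc k) fx q (inj₂ (a , e , fa , r)) = go k fa (step fx fa e q) r

  ¬presentable₂ : ¬ Presentable 2 petersen
  ¬presentable₂ (w , P) = triangle-free⇒⊥ (o zero) {o (suc zero)} {o (Fin.fromℕ 4)} {i zero}
    (λ ()) (λ ()) (λ ()) (inj₂ (inj₁ refl)) (inj₁ (inj₂ (refl , refl))) refl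
    (connected (o zero)) (λ {x} _ → connected x) (λ {x} {y} → free x y) P
    where
    free : ∀ x y → x ~ o zero → y ~ o zero → ¬ (x ~ y)
    free = from-yes (all⊎? λ x → all⊎? λ y → (x ~? o zero) →-dec ((y ~? o zero) →-dec ¬? (x ~? y)))

module PrismChords (m : ℕ) (3≤n : 3 ≤ suc m) where
  open Cyclic m
  open ChordsOf (prism n 3≤n)

  -- The other cycle without the partner of u is a path, to which the remaining
  -- vertices on the cycle of u are joined by the rungs.
  module _ (κ : Fin n → V (prism n 3≤n)) (ι : Fin n → V (prism n 3≤n))
    (cover : ∀ x → (∃[ j ] x ≡ κ j) ⊎ (∃[ j ] x ≡ ι j))
    (ι-edge : ∀ k → ι (e k) ~ ι (e (suc k)))
    (rung : ∀ k → κ k ~ ι k) (rung⁻¹ : ∀ {j k} → ι j ~ κ k → j ≡ k)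
    (κ≢ι : ∀ {j k} → κ j ≢ ι k) (u : Fin n) where

    private
      s = toℕ u
      -- Here b is the offset from u along the other cycle. Offset 0 is the partner of `κ u`; the
      -- offsets 1 to n - 1 form the path that remains.
      at : ℕ → V (prism n 3≤n)
      at b = ι (e (b + s))

    e-s : e s ≡ u
    e-s = e-toℕ u

    far-ι : ∀ {j} → j ≢ u → Far (κ u) (ι j)
    far-ι j≢u = κ≢ι ∘ sym , j≢u ∘ rung⁻¹

    far-at : ∀ b → 0 < b → b < n → Far (κ u) (at b)
    far-at b 0<b b<n = far-ι λ p → e-≢ (Nat.+-monoˡ-< s 0<b)
      (Nat.<-≤-trans (Nat.+-monoˡ-< s b<n) (Nat.≤-reflexive (Nat.+-comm n s))) (trans e-s (sym p))

    connectedAway : ConnectedAwayFrom (κ u)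
    connectedAway Q step {x} {y} far-x far-y q =
      from-path far-y (to-path far-x q)
      where
      ~-swap : ∀ x y → x ~ y → y ~ x
      ~-swap x y = Graph.~-sym (prism n 3≤n) {x} {y}
      up : ∀ b → suc b < n → Q (at 1) → Q (at (suc b))
      up zero    l q = q
      up (suc b) l q = step (far-at (suc b) (s≤s z≤n) l′) (far-at (suc (suc b)) (s≤s z≤n) l) (ι-edge (suc b + s)) (up b l′ q)
        where l′ = Nat.<-trans (Nat.n<1+n (suc b)) l
      down : ∀ b → suc b < n → Q (at (suc b)) → Q (at 1)
      down zero    l q = q
      down (suc b) l q = down b l′ (step (far-at (suc (suc b)) (s≤s z≤n) l) (far-at (suc b) (s≤s z≤n) l′)
        (~-swap (at (suc b)) (at (suc (suc b))) (ι-edge (suc b + s))) q)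
        where l′ = Nat.<-trans (Nat.n<1+n (suc b)) l
      base : ∀ {j} → j ≢ u → Q (ι j) ⇔ Q (at 1)
      base {j} j≢u with e-shift s j
      ... | zero  , l , refl = contradiction e-s j≢u
      ... | suc b , l , refl = mk⇔ (down b l) (up b l)
      ≢u : ∀ {j} → Far (κ u) (κ j) → j ≢ u
      ≢u (f , _) refl = f refl
      ≢u′ : ∀ {j} → Far (κ u) (ι j) → j ≢ u
      ≢u′ (_ , f) refl = f (~-swap (κ u) (ι u) (rung u))
      to-path : ∀ {x} → Far (κ u) x → Q x → Q (at 1)
      to-path {x} fx q with cover x
      ... | inj₁ (j , refl) = Equivalence.to (base (≢u fx)) (step fx (far-ι (≢u fx)) (rung j) q)
      ... | inj₂ (j , refl) = Equivalence.to (base (≢u′ fx)) q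
      from-path : ∀ {x} → Far (κ u) x → Q (at 1) → Q x
      from-path {x} fx q with cover x
      ... | inj₁ (j , refl) = step (far-ι (≢u fx)) fx (~-swap (κ j) (ι j) (rung j)) (Equivalence.from (base (≢u fx)) q)
      ... | inj₂ (j , refl) = Equivalence.from (base (≢u′ fx)) q

  connected : ∀ x → ConnectedAwayFrom x
  connected (o u) = connectedAway inj₁ inj₂
    (λ { (o j) → inj₁ (j , refl) ; (i j) → inj₂ (j , refl) })
    (λ k → inj₁ (next-e k)) (λ k → refl) (λ p → sym p) (λ ()) u
  connected (i u) = connectedAway inj₂ inj₁
    (λ { (o j) → inj₂ (j , refl) ; (i j) → inj₁ (j , refl) })
    (λ k → inj₁ (next-e k)) (λ k → refl) (λ p → p) (λ ()) u

-- For n = 3 the outer cycle is itself a triangle. The rung at `o 0` supplies the third neighbour p,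
-- and the other two rungs supply the private neighbours.
prism₃-¬presentable₂ : ∀ 3≤n → ¬ Presentable 2 (prism 3 3≤n)
prism₃-¬presentable₂ p (w , P) = triangle⇒⊥ (o zero)
  {i zero} {o (suc zero)} {o (suc (suc zero))} {i (suc zero)} {i (suc (suc zero))}
  (λ ()) (λ ()) (λ ()) (inj₂ (inj₁ refl)) (inj₁ (inj₂ (refl , refl))) refl (inj₁ (inj₁ refl))
  (λ {x} → near x) (λ ()) (λ ())
  refl (λ ()) (λ ()) refl (λ ()) (λ ())
  (connected _) (connected _) (connected _) (connected _) P
  where
  open PrismChords 2 p
  open ChordsOf (prism 3 p)
  near : ∀ x → x ~ o zero → x ≡ i zero ⊎ x ≡ o (suc zero) ⊎ x ≡ o (suc (suc zero))
  near = from-yes (all⊎? λ x → (x ~? o zero) →-dec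
    ((x ≟ᶠ i zero) ⊎-dec ((x ≟ᶠ o (suc zero)) ⊎-dec (x ≟ᶠ o (suc (suc zero))))))

module _ (k : ℕ) (3≤n : 3 ≤ 4 + k) where
  open Cyclic (3 + k)
  open PrismChords (3 + k) 3≤n
  open ChordsOf (prism n 3≤n)

  private
    last : Fin n
    last = Fin.fromℕ (3 + k)

  near-zero : ∀ j → next zero j ⊎ next j zero → toℕ j ≡ 1 ⊎ toℕ j ≡ 3 + k
  near-zero j (inj₁ (inj₁ p)) = inj₁ (sym p)
  near-zero j (inj₂ (inj₂ (p , _))) = inj₂ (Nat.suc-injective p)

  -- The cycle neighbours of 0 have indices 1 and n - 1. As n is at least 4, these are not
  -- consecutive in either direction, so 0 lies on no triangle of its cycle.
  ¬next : ∀ x y → toℕ x ≡ 1 ⊎ toℕ x ≡ 3 + k → toℕ y ≡ 1 ⊎ toℕ y ≡ 3 + k → ¬ next x y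
  ¬next x y (inj₁ p) (inj₁ q) (inj₁ r) rewrite p | q = contradiction r λ ()
  ¬next x y (inj₁ p) (inj₂ q) (inj₁ r) rewrite p | q = contradiction r λ ()
  ¬next x y (inj₂ p) (inj₁ q) (inj₁ r) rewrite p | q = contradiction r λ ()
  ¬next x y (inj₂ p) (inj₂ q) (inj₁ r) rewrite p | q = contradiction r Nat.1+n≢n
  ¬next x y _ (inj₁ q) (inj₂ (_ , r)) = contradiction (trans (sym q) r) λ ()
  ¬next x y _ (inj₂ q) (inj₂ (_ , r)) = contradiction (trans (sym q) r) λ ()

  zero-far : ∀ {j} → next zero j ⊎ next j zero → j ≢ zero
  zero-far {j} p refl with near-zero zero p
  ... | inj₁ ()
  ... | inj₂ ()

  free : ∀ x y → x ~ o zero → y ~ o zero → ¬ (x ~ y)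
  free (o x) (o y) p q (inj₁ r) = ¬next x y (near-zero x (Sum.swap p)) (near-zero y (Sum.swap q)) r
  free (o x) (o y) p q (inj₂ r) = ¬next y x (near-zero y (Sum.swap q)) (near-zero x (Sum.swap p)) r
  free (o x) (i y) p refl r = zero-far (Sum.swap p) r
  free (i x) (o y) refl q r = zero-far (Sum.swap q) r
  free (i x) (i y) refl refl r = ~-irrefl {i zero} r

  prism-¬presentable₂′ : ¬ Presentable 2 (prism n 3≤n)
  prism-¬presentable₂′ (w , P) = triangle-free⇒⊥ (o zero) {o (suc zero)} {o last} {i zero}
    (λ ()) (λ ()) (λ ()) (inj₂ (inj₁ refl)) (inj₁ (inj₂ (cong suc (Fin.toℕ-fromℕ (3 + k)) , refl))) refl
    (connected (o zero)) (λ {x} _ → connected x) (λ {x} {y} → free x y) P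

prism-¬presentable₂ : ∀ n (3≤n : 3 ≤ n) → ¬ Presentable 2 (prism n 3≤n)
prism-¬presentable₂ 0 ()
prism-¬presentable₂ 1 (s≤s ())
prism-¬presentable₂ 2 (s≤s (s≤s ()))
prism-¬presentable₂ 3 = prism₃-¬presentable₂
prism-¬presentable₂ (suc (suc (suc (suc k)))) = prism-¬presentable₂′ k

-- Both bounds under isomorphisms and operations.

module _ {G H : Graph} (iso : G ≅ H) where
  open _≅_ iso
  open Inverse bijection using (to; from; strictlyInverseˡ; strictlyInverseʳ)

  ≅⇒↪ : Embedding G H
  ≅⇒↪ = record
    { to        = to
    ; from      = just ∘ from
    ; from-to   = λ x → cong just (strictlyInverseʳ x)
    ; to-from   = λ { {y = y} refl → sym (strictlyInverseˡ y) }
    ; preserves = λ {x} {y} → Equivalence.to (preserves x y)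
    ; reflects  = λ {x} {y} → Equivalence.from (preserves x y)
    }

  ≅⇒↩ : Embedding H G
  ≅⇒↩ = record
    { to        = from
    ; from      = just ∘ to
    ; from-to   = λ x → cong just (strictlyInverseˡ x)
    ; to-from   = λ { {y = y} refl → sym (strictlyInverseʳ y) }
    ; preserves = λ {x} {y} e → Equivalence.from (preserves (from x) (from y))
        (subst₂ (Graph._~_ H) (sym (strictlyInverseˡ x)) (sym (strictlyInverseˡ y)) e)
    ; reflects  = λ {x} {y} e → subst₂ (Graph._~_ H) (strictlyInverseˡ x) (strictlyInverseˡ y)
        (Equivalence.to (preserves (from x) (from y)) e)
    }

↪-glue : ∀ G N {L : REL (V G) (V N) 0ℓ} {L? : Decidable L} → Embedding G (glue G N L L?)
↪-glue G N = record
  { to        = inj₁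
  ; from      = isInj₁
  ; from-to   = λ x → refl
  ; to-from   = λ { {y = inj₁ x} refl → refl }
  ; preserves = λ e → e
  ; reflects  = λ e → e
  }

-- The invariant carried through the operations. The nonadjacent pair rules out 0-uniform and
-- 1-uniform words, and its distinctness provides the second vertex needed to attach a pendant path.
record Three (G : Graph) : Set where
  field
    {x y}         : V G
    distinct      : x ≢ y
    nonadjacent   : ¬ Graph._~_ G x y
    ¬presentable₂ : ¬ Presentable 2 G
    presentable₃  : Presentable 3 G

module _ {G : Graph} (t : Three G) where
  open Three t

  Three⇒ℛ₃ : G ∈ ℛ 3
  Three⇒ℛ₃ with r@(w , _ , represents) ← presentable⇒uniformlyRepresentable G presentable₃ =
    (w , represents) , r , λ j → lower j ∘ uniformlyRepresentable⇒presentable G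
    where
    -- With at most one occurrence of each letter, any two letters alternate, contrary to the
    -- nonadjacent pair.
    few : ∀ j → (∀ p → (# only true) p ≡ j → (# only false) p ≡ j → Alternating p) → ¬ Presentable j G
    few j alternating (w , P) = nonadjacent (complete distinct (alternating (trace (Graph._≟ᵥ_ G) x y w)
      (trans (#-true (Graph._≟ᵥ_ G) x y w) (count x)) (trans (#-false (Graph._≟ᵥ_ G) distinct w) (count y))))
      where open Presents P
    lower : ∀ j → Presentable j G → 3 ≤ j
    lower 0 = λ P → contradiction P (few 0 (everyPattern-sound 0 0 isAlternating tt))
    lower 1 = λ P → contradiction P (few 1 (everyPattern-sound 1 1 isAlternating tt))
    lower 2 = λ P → contradiction P ¬presentable₂
    lower (suc (suc (suc j))) P = s≤s (s≤s (s≤s z≤n))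

  Three-extend : ∀ {H} → Embedding G H → Presentable 3 H → Three H
  Three-extend E P = record
    { distinct      = distinct ∘ to-injective E
    ; nonadjacent   = nonadjacent ∘ Embedding.reflects E
    ; ¬presentable₂ = ¬presentable₂ ∘ Presentable-embedding E
    ; presentable₃  = P
    }

-- The 3-uniform word comes to G along the embedding of G in H, the lower bound along the inverse
-- embedding.
Three-≅ : ∀ {G H} → G ≅ H → Three H → Three G
Three-≅ iso t = Three-extend t (≅⇒↩ iso) (Presentable-embedding (≅⇒↪ iso) (Three.presentable₃ t))

Three-↝ : ∀ {G H} → G ↝ H → Three G → Three H
Three-↝ {G} (operation₁ v (suc ℓ) (s≤s _) iso) t = Three-≅ iso (Three-extend t (↪-glue G (path (suc ℓ)))
  (attachPath-presentable G v ℓ (_ , _ , Three.distinct t) (Three.presentable₃ t)))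
Three-↝ {G} (operation₂ x y (suc (suc (suc ℓ))) x≢y (s≤s (s≤s (s≤s _))) iso) t =
  Three-≅ iso (Three-extend t (↪-glue G (path (suc (suc ℓ))))
  (joinByPath-presentable G x≢y ℓ (Three.presentable₃ t)))

Three-↝* : ∀ {G H} → G ↝* H → Three G → Three H
Three-↝* ε        t = t
Three-↝* (s ◅ ss) t = Three-↝* ss (Three-↝ s t)

petersen-Three : Three petersen
petersen-Three = record
  { x = o zero ; y = i (suc zero)
  ; distinct = λ () ; nonadjacent = λ ()
  ; ¬presentable₂ = PetersenChords.¬presentable₂ ; presentable₃ = petersen-presentable }

prism-Three : ∀ n 3≤n → Three (prism n 3≤n)
prism-Three (suc zero) (s≤s ())
prism-Three (suc (suc n)) 3≤n = record
  { x = o zero ; y = i (suc zero)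
  ; distinct = λ () ; nonadjacent = λ ()
  ; ¬presentable₂ = prism-¬presentable₂ _ 3≤n ; presentable₃ = prism-presentable _ 3≤n }

theorem13 : (∀ G → IsPetersen G → G ∈ ℛ 3)
    × (∀ n G → IsPrism n G → G ∈ ℛ 3)
    × (∀ G H → IsPetersen G ⊎ (∃[ n ] IsPrism n G) → G ↝* H → H ∈ ℛ 3)
theorem13 =
    (λ G iso → Three⇒ℛ₃ (Three-≅ iso petersen-Three))
  , (λ n G (p , iso) → Three⇒ℛ₃ (Three-≅ iso (prism-Three n p)))
  , λ { G H (inj₁ iso) s → Three⇒ℛ₃ (Three-↝* s (Three-≅ iso petersen-Three))
      ; G H (inj₂ (n , p , iso)) s → Three⇒ℛ₃ (Three-↝* s (Three-≅ iso (prism-Three n p))) }
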